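{- Let $m,n\ge 1$ and let $A\in\{0,1\}^{m\times n}$ have exactly three ones in each row. If $\operatorname{conv}(\mathrm{NPadj}(A))$ is not a line segment (equivalently, $\mathrm{NPadj}(A)$ has more than two points), then there is no finite simple graph $G$ with $\mathrm{NPadj}(A)\le_a \mathrm{Stable}(G)$. In other words, $\operatorname{conv}(\mathrm{NPadj}(A))$ is not affinely equivalent to any face of $\operatorname{conv}(\mathrm{Stable}(G))$, for any graph $G$.
   Context: Polytopes are identified with their vertex sets; every 0/1 set $X$ is the vertex set of $\operatorname{conv}(X)$. **Definition of $\mathrm{NPadj}(A)$.** Let $m,n\ge1$ and let $A\in\{0,1\}^{m\times n}$ have exactly three ones in each row. Index the coordinates of $\mathbb{R}^{3n+3}$ by $y_1,y_2,y_3$ and by $x_j,\bar x_j,x'_j$ for $j\in[n]=\{1,\dots,n\}$. Then $\mathrm{NPadj}(A)$ is the set of vectors in $\{0,1\}^{3n+3}$ satisfying: - $x_j+\bar x_j=1$ for all $j\in[n]$; - $y_1+y_2+x'_j+\bar x_j=2$ for all $j\in[n]$; - for each row of $A$, with ones in columns $i<j<k$, the equation $y_3+x_i+x'_j+x'_k=2$. **Graph polytope.** For a graph $G=(V,E)$, $\mathrm{Stable}(G)=\{x\in\{0,1\}^V : x_u+x_v\le 1 \text{ for every edge } \{u,v\}\in E\}$. **Affine reduction of polytopes.** For finite sets $P,Q$ of 0/1 vectors, $P\le_a Q$ means: there is an affine map $\alpha$ defined on $\operatorname{conv}(P)$, injective there, such that $\alpha(\operatorname{conv}(P))$ is a face (possibly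 improper) of $\operatorname{conv}(Q)$. -}

module Defs where

open import Algebra.Apartness.Bundles using (HeytingField)
open import Algebra.Apartness.Structures using (IsHeytingField)
open import Algebra.Bundles using (CommutativeRing)
open import Algebra.Core using (Op₁; Op₂)
import Algebra.Properties.CommutativeMonoid.Sum as CommutativeMonoidSum
import Algebra.Properties.Semiring.Sum as SemiringSum
open import Data.Fin.Base as Fin using (Fin; toℕ; combine; _↑ˡ_; _↑ʳ_)
open import Data.Fin.Patterns using (0F; 1F; 2F)
open import Data.Nat.Base as ℕ using (ℕ)
open import Data.Nat.Properties using (+-0-commutativeMonoid)
open import Data.Product.Base using (_×_; _,_; Σ-syntax; ∃-syntax)
open import Data.Sum.Base using (_⊎_)
open import Data.Vec.Functional using (Vector)
import Data.Vec.Functional.Relation.Binary.Equality.Setoid as VectorEquality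
open import Function.Bundles using (_⇔_)
open import Level using (Level; _⊔_; 0ℓ)
open import Relation.Binary.Core using (Rel)
open import Relation.Binary.Definitions
  using (Symmetric; Irreflexive; Decidable)
open import Relation.Binary.PropositionalEquality using (_≡_; _≗_)
open import Relation.Binary.Structures using (IsStrictPartialOrder)
open import Relation.Nullary.Negation using (¬_)
open import Relation.Unary using (Pred)

open CommutativeMonoidSum +-0-commutativeMonoid using () renaming (sum to sumℕ)

private
  variable
    c ℓ₁ ℓ₂ p q : Level
    m n : ℕ

-- Ordered fields play the role of ℝ.  The order is axiomatised by its strict
-- part, with x # y given by x < y ⊎ y < x, so that no decidability of _<_ or
-- _≈_ is assumed.  Classically this is the usual notion of ordered field.

record OrderedField c ℓ₁ ℓ₂ : Set (Level.suc (c ⊔ ℓ₁ ⊔ ℓ₂)) where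
  infix  8 -_
  infixl 7 _*_
  infixl 6 _+_
  infix  4 _≈_ _<_ _≤_
  field
    Carrier : Set c
    _≈_     : Rel Carrier ℓ₁
    _<_     : Rel Carrier ℓ₂
    _+_     : Op₂ Carrier
    _*_     : Op₂ Carrier
    -_      : Op₁ Carrier
    0#      : Carrier
    1#      : Carrier
    isHeytingField : IsHeytingField _≈_ (λ x y → x < y ⊎ y < x)
                                    _+_ _*_ -_ 0# 1#
    isStrictPartialOrder : IsStrictPartialOrder _≈_ _<_
    +-monoˡ-< : ∀ {x y} z → x < y → x + z < y + z
    *-pos     : ∀ {x y} → 0# < x → 0# < y → 0# < x * y

  _≤_ : Rel Carrier ℓ₂
  x ≤ y = ¬ (y < x)

  heytingField : HeytingField c ℓ₁ ℓ₂
  heytingField = record { isHeytingField = isHeytingField }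

  commutativeRing : CommutativeRing c ℓ₁
  commutativeRing = record
    { isCommutativeRing = IsHeytingField.isCommutativeRing isHeytingField }

  open CommutativeRing commutativeRing public using (setoid; semiring; _-_)

ZeroOneVector : ℕ → Set
ZeroOneVector = Vector (Fin 2)

-- Distinctness of points is failure of pointwise equality, since
-- propositional equality of functions is too fine.

MoreThanTwoPoints : Pred (ZeroOneVector n) p → Set p
MoreThanTwoPoints {n = n} P =
  Σ[ v ∈ (Fin 3 → ZeroOneVector n) ]
    (∀ i → P (v i)) × (∀ {i j} → v i ≗ v j → i ≡ j)

module Polytope {c ℓ₁ ℓ₂} (K : OrderedField c ℓ₁ ℓ₂) where
  open OrderedField K
  open SemiringSum semiring using (sum)
  open VectorEquality setoid using (_≋_)

  Point : ℕ → Set c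
  Point = Vector Carrier

  _∙_ : Point n → Point n → Carrier
  x ∙ y = sum λ i → x i * y i

  bit : Fin 2 → Carrier
  bit 0F = 0#
  bit 1F = 1#

  conv : Pred (ZeroOneVector n) p → Pred (Point n) (c ⊔ ℓ₁ ⊔ ℓ₂ ⊔ p)
  conv {n = n} P x =
    ∃[ k ] Σ[ v ∈ (Fin k → ZeroOneVector n) ] Σ[ w ∈ Vector Carrier k ]
      (∀ i → P (v i))
      × (∀ i → 0# ≤ w i)
      × sum w ≈ 1#
      × x ≋ (λ j → sum λ i → w i * bit (v i j))

  IsLineSegment : Pred (Point n) p → Set (c ⊔ ℓ₁ ⊔ ℓ₂ ⊔ p)
  IsLineSegment {n = n} C =
    Σ[ a ∈ Point n ] Σ[ b ∈ Point n ]
      ¬ (a ≋ b)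
      × (∀ x → C x ⇔
          (Σ[ t ∈ Carrier ] 0# ≤ t × t ≤ 1#
            × x ≋ (λ j → (1# - t) * a j + t * b j)))

  -- C ∩ {x : a ∙ x = b} for an inequality a ∙ x ≤ b valid on C.  Taking a = 0
  -- gives the improper faces: C itself (b = 0) and the empty face (b = 1).

  IsFace : Pred (Point n) p → Pred (Point n) q → Set (c ⊔ ℓ₁ ⊔ ℓ₂ ⊔ p ⊔ q)
  IsFace {n = n} C F =
    Σ[ a ∈ Point n ] Σ[ b ∈ Carrier ]
      (∀ x → C x → a ∙ x ≤ b)
      × (∀ x → F x ⇔ (C x × a ∙ x ≈ b))

  record AffineMap (m n : ℕ) : Set c where
    field
      linear      : Vector (Point m) n
      translation : Point n

    apply : Point m → Point n
    apply x i = linear i ∙ x + translation i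

  open AffineMap public using (apply)

  InjectiveOn : AffineMap m n → Pred (Point m) p → Set (c ⊔ ℓ₁ ⊔ p)
  InjectiveOn α C = ∀ x y → C x → C y → apply α x ≋ apply α y → x ≋ y

  Image : AffineMap m n → Pred (Point m) p → Pred (Point n) (c ⊔ ℓ₁ ⊔ p)
  Image {m = m} α C y = Σ[ x ∈ Point m ] C x × apply α x ≋ y

  infix 4 _≤ₐ_

  _≤ₐ_ : Pred (ZeroOneVector m) p → Pred (ZeroOneVector n) q →
         Set (c ⊔ ℓ₁ ⊔ ℓ₂ ⊔ p ⊔ q)
  _≤ₐ_ {m = m} {n = n} P Q =
    Σ[ α ∈ AffineMap m n ]
      InjectiveOn α (conv P) × IsFace (conv Q) (Image α (conv P))

record Graph : Set₁ where
  field
    order      : ℕ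
    Adjacent   : Rel (Fin order) 0ℓ
    symmetric  : Symmetric Adjacent
    loopless   : Irreflexive _≡_ Adjacent
    adjacent?  : Decidable Adjacent

Stable : (G : Graph) → Pred (ZeroOneVector (Graph.order G)) 0ℓ
Stable G z = ∀ u v → Adjacent u v → toℕ (z u) ℕ.+ toℕ (z v) ℕ.≤ 1
  where open Graph G

ThreeOnesPerRow : (Fin m → Fin n → Fin 2) → Set
ThreeOnesPerRow A = ∀ r → sumℕ (λ j → toℕ (A r j)) ≡ 3

module Coordinates (n : ℕ) where

  x x̄ x′ : Fin n → Fin (3 ℕ.* n ℕ.+ 3)
  x  j = combine {3} 0F j ↑ˡ 3
  x̄  j = combine {3} 1F j ↑ˡ 3
  x′ j = combine {3} 2F j ↑ˡ 3

  y₁ y₂ y₃ : Fin (3 ℕ.* n ℕ.+ 3)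
  y₁ = (3 ℕ.* n) ↑ʳ 0F
  y₂ = (3 ℕ.* n) ↑ʳ 1F
  y₃ = (3 ℕ.* n) ↑ʳ 2F

record NPadj (A : Fin m → Fin n → Fin 2) (z : ZeroOneVector (3 ℕ.* n ℕ.+ 3)) : Set where
  open Coordinates n

  ⟦_⟧ : Fin (3 ℕ.* n ℕ.+ 3) → ℕ
  ⟦ i ⟧ = toℕ (z i)

  field
    complement : ∀ j → ⟦ x j ⟧ ℕ.+ ⟦ x̄ j ⟧ ≡ 1
    link       : ∀ j → ⟦ y₁ ⟧ ℕ.+ ⟦ y₂ ⟧ ℕ.+ ⟦ x′ j ⟧ ℕ.+ ⟦ x̄ j ⟧ ≡ 2
    row        : ∀ r i j k → i Fin.< j → j Fin.< k →
                 A r i ≡ 1F → A r j ≡ 1F → A r k ≡ 1F →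
                 ⟦ y₃ ⟧ ℕ.+ ⟦ x i ⟧ ℕ.+ ⟦ x′ j ⟧ ℕ.+ ⟦ x′ k ⟧ ≡ 2

{-# OPTIONS --safe #-}

-- Two ideas.  First, a reduction P ≤ₐ Stable(G) sends the points of P to 0/1
-- points and lifts every decomposition α(z₁) + α(z₂) = u + v with u, v stable
-- to one of z₁ + z₂ inside conv(P).  Second, stable sets are closed under
-- coordinatewise majority, and if a + a* = b + b* = c + c* then
--   a + b = maj(a,b,c) + maj(a,b,c*),   a + c = maj(a,b,c) + maj(a,b*,c).
-- NPadj(A) is invariant under z ↦ 1 − z, which supplies the starred points.
-- Take for a the point with y = 0, x = 0, x′ = 1; for b a point q with
-- (y₁, y₂) = (0, 1); and for c the point q with y₁ and y₂ exchanged, which is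
-- again in NPadj(A).  Lifting the decompositions of a + b, a + c and a + c*
-- gives x-coordinates of q that equal their own complements.  Such a q exists
-- unless NPadj(A) consists of a and a* only, and then its hull is a segment.

module Submission where

open import Defs
open import Algebra.Apartness.Structures using (IsHeytingField)
open import Algebra.Bundles using (CommutativeRing)
import Algebra.Properties.CommutativeMonoid.Sum as CommutativeMonoidSum
import Algebra.Properties.Ring as RingProperties
import Algebra.Properties.Semiring.Mult as SemiringMult
import Algebra.Properties.Semiring.Sum as SemiringSum
import Algebra.Solver.Ring.NaturalCoefficients.Default as SemiringSolver
open import Data.Empty using (⊥)
open import Data.Fin.Base as Fin
  using ( Fin; suc; toℕ; punchIn; opposite; combine; remQuot; splitAt; finToFun; funToFin
        ; _↑ˡ_; _↑ʳ_)
open import Data.Fin.Patterns using (0F; 1F; 2F)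
open import Data.Fin.Properties
  using ( _≟_; _<?_; all?; any?; ¬∀⟶∃¬; splitAt-↑ˡ; splitAt-↑ʳ; splitAt⁻¹-↑ˡ; splitAt⁻¹-↑ʳ
        ; remQuot-combine; combine-remQuot; opposite-involutive; finToFun-funToFin)
open import Data.Nat.Base as ℕ using (ℕ)
import Data.Nat.Properties as ℕ
open import Data.Product.Base using (_×_; _,_; Σ-syntax; ∃-syntax; proj₁; proj₂; uncurry)
open import Data.Sum.Base using (_⊎_; inj₁; inj₂; [_,_]′)
open import Data.Vec.Functional using (Vector; removeAt)
import Data.Vec.Functional.Relation.Binary.Equality.Setoid as VectorEquality
open import Function.Base using (_∘_)
open import Function.Bundles using (_⇔_; mk⇔; Equivalence)
open import Level using (Level)
import Relation.Binary.Reasoning.Setoid as SetoidReasoning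
open import Relation.Binary.PropositionalEquality as ≡ using (_≡_; _≢_; _≗_)
open import Relation.Binary.Structures using (IsStrictPartialOrder)
open import Relation.Nullary.Decidable
  using (Dec; yes; no; True; toWitness; map′; _×-dec_; _→-dec_)
open import Relation.Nullary.Negation using (¬_; contradiction)
open import Relation.Unary using (Pred; Decidable)

open CommutativeMonoidSum ℕ.+-0-commutativeMonoid using () renaming (sum to sumℕ)

private
  variable
    p q : Level
    m n : ℕ

-- Order and arithmetic in an ordered field without decidable comparison.

module OrderedFieldProperties {c ℓ₁ ℓ₂ : Level} (K : OrderedField c ℓ₁ ℓ₂) where
  open OrderedField K
  open CommutativeRing commutativeRing public
    using ( refl; sym; trans; reflexive; +-cong; +-congˡ; +-congʳ; *-cong; *-congˡ; *-congʳ
          ; +-assoc; +-comm; +-identityˡ; +-identityʳ; -‿inverseˡ; -‿inverseʳ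
          ; *-assoc; *-comm; *-identityˡ; *-identityʳ; zeroˡ; zeroʳ; distribˡ
          ; ring; commutativeSemiring)
  open IsHeytingField isHeytingField public using (#-cotrans; tight; #⇒invertible; invertible⇒#)
  open RingProperties ring public using (-‿distribˡ-*; -‿involutive; -0#≈0#)
  open IsStrictPartialOrder isStrictPartialOrder public
    using ()
    renaming (irrefl to <-irrefl; trans to <-trans; asym to <-asym;
              <-respˡ-≈ to <-respˡ; <-respʳ-≈ to <-respʳ)
  open SemiringMult semiring using (×-homo-+) renaming (_×_ to _·_)
  open SemiringSum semiring using (sum) renaming (sum-replicate-zero to sum-zero)
  open SetoidReasoning setoid

  [x+y]-y≈x : ∀ x y → x + y - y ≈ x
  [x+y]-y≈x x y = begin
    x + y - y    ≈⟨ +-assoc x y (- y) ⟩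
    x + (y - y)  ≈⟨ +-congˡ (-‿inverseʳ y) ⟩
    x + 0#       ≈⟨ +-identityʳ x ⟩
    x            ∎

  [x-y]+y≈x : ∀ x y → x - y + y ≈ x
  [x-y]+y≈x x y = begin
    x - y + y      ≈⟨ +-assoc x (- y) y ⟩
    x + (- y + y)  ≈⟨ +-congˡ (-‿inverseˡ y) ⟩
    x + 0#         ≈⟨ +-identityʳ x ⟩
    x              ∎

  +-cancelʳ : ∀ {x y} z → x + z ≈ y + z → x ≈ y
  +-cancelʳ {x} {y} z eq = trans (sym ([x+y]-y≈x x z)) (trans (+-congʳ eq) ([x+y]-y≈x y z))

  +-cancelˡ : ∀ {x y} z → z + x ≈ z + y → x ≈ y
  +-cancelˡ z eq = +-cancelʳ z (trans (+-comm _ z) (trans eq (+-comm z _)))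

  +-cancelʳ-< : ∀ {x y} z → x + z < y + z → x < y
  +-cancelʳ-< {x} {y} z lt =
    <-respˡ ([x+y]-y≈x x z) (<-respʳ ([x+y]-y≈x y z) (+-monoˡ-< (- z) lt))

  +-monoʳ-< : ∀ {x y} z → x < y → z + x < z + y
  +-monoʳ-< z lt = <-respˡ (+-comm _ z) (<-respʳ (+-comm _ z) (+-monoˡ-< z lt))

  x<y⇒0<y-x : ∀ {x y} → x < y → 0# < y - x
  x<y⇒0<y-x {x} lt = <-respˡ (-‿inverseʳ x) (+-monoˡ-< (- x) lt)

  x<0⇒0<-x : ∀ {x} → x < 0# → 0# < - x
  x<0⇒0<-x lt = <-respʳ (+-identityˡ _) (x<y⇒0<y-x lt)

  -- Invertibility of `1# - 0#` puts `1#` apart from `0#`. Were it negative, `- 1#` would be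
  -- positive, and so would its square, which is `1#`.
  0<1 : 0# < 1#
  0<1 with invertible⇒# {1#} {0#} (1# , 1[1-0]≈1 , [1-0]1≈1)
    where
    1-0≈1 : 1# - 0# ≈ 1#
    1-0≈1 = trans (+-congˡ -0#≈0#) (+-identityʳ 1#)
    1[1-0]≈1 = trans (*-identityˡ _) 1-0≈1
    [1-0]1≈1 = trans (*-identityʳ _) 1-0≈1
  ... | inj₂ 0<1 = 0<1
  ... | inj₁ 1<0 = <-respʳ square (*-pos (x<0⇒0<-x 1<0) (x<0⇒0<-x 1<0))
    where
    square : - 1# * - 1# ≈ 1#
    square = begin
      - 1# * - 1#      ≈⟨ -‿distribˡ-* 1# (- 1#) ⟨
      - (1# * - 1#)    ≈⟨ -‿cong (*-identityˡ (- 1#)) ⟩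
      - (- 1#)         ≈⟨ -‿involutive 1# ⟩
      1#               ∎
      where open CommutativeRing commutativeRing using (-‿cong)

  0≉1 : ¬ (0# ≈ 1#)
  0≉1 eq = <-irrefl eq 0<1

  ≈⇒≤ : ∀ {x y} → x ≈ y → x ≤ y
  ≈⇒≤ eq lt = <-irrefl (sym eq) lt

  <⇒≤ : ∀ {x y} → x < y → x ≤ y
  <⇒≤ = <-asym

  ≤-antisym : ∀ {x y} → x ≤ y → y ≤ x → x ≈ y
  ≤-antisym {x} {y} x≤y y≤x = proj₁ (tight x y) λ where
    (inj₁ x<y) → y≤x x<y
    (inj₂ y<x) → x≤y y<x

  -- Since `_≤_` is a negated strict inequality, chaining is not immediate: cotransitivity compares
  -- `y` with the endpoints of the assumed `z < x`, and each outcome contradicts one of the two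
  -- bounds.
  ≤-trans : ∀ {x y z} → x ≤ y → y ≤ z → x ≤ z
  ≤-trans {x} {y} {z} x≤y y≤z z<x with #-cotrans (inj₁ z<x) y
  ... | inj₁ (inj₁ z<y) = y≤z z<y
  ... | inj₁ (inj₂ y<z) = x≤y (<-trans y<z z<x)
  ... | inj₂ (inj₁ y<x) = x≤y y<x
  ... | inj₂ (inj₂ x<y) = y≤z (<-trans z<x x<y)

  ≤-respˡ : ∀ {x y z} → x ≈ y → x ≤ z → y ≤ z
  ≤-respˡ eq x≤z z<y = x≤z (<-respʳ (sym eq) z<y)

  ≤-respʳ : ∀ {x y z} → x ≈ y → z ≤ x → z ≤ y
  ≤-respʳ eq z≤x y<z = z≤x (<-respˡ (sym eq) y<z)

  +-monoˡ-≤ : ∀ {x y} z → x ≤ y → x + z ≤ y + z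
  +-monoˡ-≤ z x≤y lt = x≤y (+-cancelʳ-< z lt)

  +-monoʳ-≤ : ∀ {x y} z → x ≤ y → z + x ≤ z + y
  +-monoʳ-≤ z x≤y = ≤-respˡ (+-comm _ z) (≤-respʳ (+-comm _ z) (+-monoˡ-≤ z x≤y))

  +-mono-≤ : ∀ {w x y z} → w ≤ x → y ≤ z → w + y ≤ x + z
  +-mono-≤ {w} {x} {y} {z} w≤x y≤z = ≤-trans (+-monoˡ-≤ y w≤x) (+-monoʳ-≤ x y≤z)

  +-nonNeg : ∀ {x y} → 0# ≤ x → 0# ≤ y → 0# ≤ x + y
  +-nonNeg 0≤x 0≤y = ≤-respˡ (+-identityˡ 0#) (+-mono-≤ 0≤x 0≤y)

  x≤y⇒0≤y-x : ∀ {x y} → x ≤ y → 0# ≤ y - x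
  x≤y⇒0≤y-x {x} x≤y = ≤-respˡ (-‿inverseʳ x) (+-monoˡ-≤ (- x) x≤y)

  -- The conclusion is a negation, so positivity of both factors may be assumed up to double
  -- negation: a nonnegative factor that is not positive is zero and makes the product zero.
  *-nonNeg : ∀ {x y} → 0# ≤ x → 0# ≤ y → 0# ≤ x * y
  *-nonNeg {x} {y} 0≤x 0≤y xy<0 = 0≮x λ where
      0<x → 0≮y λ 0<y → <-asym xy<0 (*-pos 0<x 0<y)
    where
    0≮y : ¬ ¬ (0# < y)
    0≮y y≤0 = <-irrefl (trans (*-congˡ (≤-antisym y≤0 0≤y)) (zeroʳ x)) xy<0
    0≮x : ¬ ¬ (0# < x)
    0≮x x≤0 = <-irrefl (trans (*-congʳ (≤-antisym x≤0 0≤x)) (zeroˡ y)) xy<0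

  *-difference : ∀ t x y → t * (y - x) + t * x ≈ t * y
  *-difference t x y = trans (sym (distribˡ t (y - x) x)) (*-congˡ ([x-y]+y≈x y x))

  *-monoˡ-≤ : ∀ {t x y} → 0# ≤ t → x ≤ y → t * x ≤ t * y
  *-monoˡ-≤ {t} {x} {y} 0≤t x≤y = ≤-respˡ (+-identityˡ _) (≤-respʳ (*-difference t x y)
    (+-monoˡ-≤ (t * x) (*-nonNeg 0≤t (x≤y⇒0≤y-x x≤y))))

  *-monoˡ-< : ∀ {t x y} → 0# < t → x < y → t * x < t * y
  *-monoˡ-< {t} {x} {y} 0<t x<y = <-respˡ (+-identityˡ _) (<-respʳ (*-difference t x y)
    (+-monoˡ-< (t * x) (*-pos 0<t (x<y⇒0<y-x x<y))))

  -- Cotransitivity places `x` relative to `0#` or to `x + y`; every outcome exhibits a positive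
  -- summand, so no sign has to be decided.
  0<x+y⇒0<x⊎0<y : ∀ {x y} → 0# < x + y → 0# < x ⊎ 0# < y
  0<x+y⇒0<x⊎0<y {x} {y} 0<x+y with #-cotrans (inj₁ 0<x+y) x
  ... | inj₁ (inj₁ 0<x) = inj₁ 0<x
  ... | inj₁ (inj₂ x<0) = inj₂ (<-trans 0<x+y (<-respʳ (+-identityˡ y) (+-monoˡ-< y x<0)))
  ... | inj₂ (inj₁ x<x+y) = inj₂ (+-cancelʳ-< x (<-respˡ (sym (+-identityˡ x)) (<-respʳ (+-comm x y) x<x+y)))
  ... | inj₂ (inj₂ x+y<x) = inj₁ (<-trans 0<x+y x+y<x)

  -- Slack in either bound would make the weighted sum strictly smaller. This serves both for faces,
  -- where a valid inequality is attained, and for extreme values of the interval from 0 to 1.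
  tight-sum : ∀ {t u v a b} → 0# < t → u ≤ a → v ≤ b → u + t * v ≈ a + t * b → u ≈ a × v ≈ b
  tight-sum {t} {u} {v} {a} {b} 0<t u≤a v≤b eq = ≤-antisym u≤a a≤u , ≤-antisym v≤b b≤v
    where
    a≤u : a ≤ u
    a≤u u<a = +-monoʳ-≤ a (*-monoˡ-≤ (<⇒≤ 0<t) v≤b)
      (<-respˡ eq (+-monoˡ-< (t * v) u<a))
    b≤v : b ≤ v
    b≤v v<b = +-monoˡ-≤ (t * b) u≤a
      (<-respˡ eq (+-monoʳ-< u (*-monoˡ-< 0<t v<b)))

  nonNeg-sum≈0 : ∀ {x y} → 0# ≤ x → 0# ≤ y → x + y ≈ 0# → x ≈ 0# × y ≈ 0#
  nonNeg-sum≈0 {x} {y} 0≤x 0≤y eq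
    using 0≈x , 0≈y ← tight-sum {u = 0#} {v = 0#} {a = x} {b = y} 0<1 0≤x 0≤y
      (trans (+-identityˡ _) (trans (zeroʳ 1#) (trans (sym eq) (+-congˡ (sym (*-identityˡ y))))))
    = sym 0≈x , sym 0≈y

  positive⇒invertible : ∀ {x} → 0# < x → ∃[ g ] 0# ≤ g × g * x ≈ 1#
  positive⇒invertible {x} 0<x with #⇒invertible (inj₂ 0<x)
  ... | g , g[x-0]≈1 , _ = g , 0≤g , gx≈1
    where
    gx≈1 : g * x ≈ 1#
    gx≈1 = trans (*-congˡ (sym (trans (+-congˡ -0#≈0#) (+-identityʳ x)))) g[x-0]≈1
    0≤g : 0# ≤ g
    0≤g g<0 = <-asym 0<1 (<-respˡ (trans (*-comm x g) gx≈1) (<-respʳ (zeroʳ x) (*-monoˡ-< 0<x g<0)))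

  ·1-nonNeg : ∀ k → 0# ≤ k · 1#
  ·1-nonNeg ℕ.zero    = ≈⇒≤ refl
  ·1-nonNeg (ℕ.suc k) = +-nonNeg (<⇒≤ 0<1) (·1-nonNeg k)

  -- Characteristic zero. It carries equations between sums of bits from the field back to the
  -- naturals, where they can be checked case by case.
  ·1-injective : ∀ j k → j · 1# ≈ k · 1# → j ≡ k
  ·1-injective ℕ.zero ℕ.zero _ = ≡.refl
  ·1-injective ℕ.zero (ℕ.suc k) eq =
    contradiction (sym (proj₁ (nonNeg-sum≈0 (<⇒≤ 0<1) (·1-nonNeg k) (sym eq)))) 0≉1
  ·1-injective (ℕ.suc j) ℕ.zero eq =
    contradiction (sym (proj₁ (nonNeg-sum≈0 (<⇒≤ 0<1) (·1-nonNeg j) eq))) 0≉1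
  ·1-injective (ℕ.suc j) (ℕ.suc k) eq = ≡.cong ℕ.suc (·1-injective j k (+-cancelˡ 1# eq))

  sum-mono-≤ : ∀ {k} {f g : Vector Carrier k} → (∀ i → f i ≤ g i) → sum f ≤ sum g
  sum-mono-≤ {ℕ.zero}  f≤g = ≈⇒≤ refl
  sum-mono-≤ {ℕ.suc k} f≤g = +-mono-≤ (f≤g 0F) (sum-mono-≤ (f≤g ∘ suc))

  sum-nonNeg : ∀ {k} {f : Vector Carrier k} → (∀ i → 0# ≤ f i) → 0# ≤ sum f
  sum-nonNeg {k} 0≤f = ≤-respˡ (sum-zero k) (sum-mono-≤ 0≤f)

  positive-summand : ∀ {k} (f : Vector Carrier k) → 0# < sum f → ∃[ i ] 0# < f i
  positive-summand {ℕ.zero}  f 0<0 = contradiction 0<0 (<-irrefl refl)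
  positive-summand {ℕ.suc k} f 0<s with 0<x+y⇒0<x⊎0<y 0<s
  ... | inj₁ 0<f₀ = 0F , 0<f₀
  ... | inj₂ 0<s′ with i , 0<fᵢ ← positive-summand (f ∘ suc) 0<s′ = suc i , 0<fᵢ

-- Convex hulls, affine maps and lifting through a reduction.

module PolytopeProperties {c ℓ₁ ℓ₂ : Level} (K : OrderedField c ℓ₁ ℓ₂) where
  open OrderedField K
  open OrderedFieldProperties K
  open Polytope K
  open SemiringSum semiring
    using (sum; sum-remove; *-distribˡ-sum; ∑-distrib-+; sum-cong-≋)
  open SemiringMult semiring using (×-homo-+) renaming (_×_ to _·_)
  open VectorEquality setoid using (_≋_)
  open SemiringSolver commutativeSemiring using (solve; _:+_; _:*_; _:=_; con)
  open SetoidReasoning setoid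

  bit-nonNeg : ∀ b → 0# ≤ bit b
  bit-nonNeg 0F = ≈⇒≤ refl
  bit-nonNeg 1F = <⇒≤ 0<1

  bit≤1 : ∀ b → bit b ≤ 1#
  bit≤1 0F = <⇒≤ 0<1
  bit≤1 1F = ≈⇒≤ refl

  bit-injective : ∀ {a b} → bit a ≈ bit b → a ≡ b
  bit-injective {0F} {0F} _  = ≡.refl
  bit-injective {0F} {1F} eq = contradiction eq 0≉1
  bit-injective {1F} {0F} eq = contradiction (sym eq) 0≉1
  bit-injective {1F} {1F} _  = ≡.refl

  toℕ·1≈bit : ∀ b → toℕ b · 1# ≈ bit b
  toℕ·1≈bit 0F = refl
  toℕ·1≈bit 1F = +-identityʳ 1#

  bit-+ : ∀ a b → (toℕ a ℕ.+ toℕ b) · 1# ≈ bit a + bit b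
  bit-+ a b = trans (×-homo-+ 1# (toℕ a) (toℕ b)) (+-cong (toℕ·1≈bit a) (toℕ·1≈bit b))

  toℕ-+⇒bit-+ : ∀ a b c d → toℕ a ℕ.+ toℕ b ≡ toℕ c ℕ.+ toℕ d → bit a + bit b ≈ bit c + bit d
  toℕ-+⇒bit-+ a b c d eq =
    trans (sym (bit-+ a b)) (trans (reflexive (≡.cong (_· 1#) eq)) (bit-+ c d))

  bit-+⇒toℕ-+ : ∀ a b c d → bit a + bit b ≈ bit c + bit d → toℕ a ℕ.+ toℕ b ≡ toℕ c ℕ.+ toℕ d
  bit-+⇒toℕ-+ a b c d eq = ·1-injective _ _ (trans (bit-+ a b) (trans eq (sym (bit-+ c d))))

  -- A bit is an endpoint of the interval that contains `u` and `v`, so both deviate from it in the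
  -- same direction and `tight-sum` leaves no deviation.
  0/1-extreme : ∀ b {t u v} → 0# < t → 0# ≤ u → u ≤ 1# → 0# ≤ v → v ≤ 1# →
                u + t * v ≈ bit b + t * bit b → v ≈ bit b
  0/1-extreme 0F 0<t 0≤u _ 0≤v _ eq = sym (proj₂ (tight-sum 0<t 0≤u 0≤v (sym eq)))
  0/1-extreme 1F 0<t _ u≤1 _ v≤1 eq = proj₂ (tight-sum 0<t u≤1 v≤1 eq)

  ∙-congˡ : ∀ (a : Point n) {x y} → x ≋ y → a ∙ x ≈ a ∙ y
  ∙-congˡ a eq = sum-cong-≋ λ i → *-congˡ (eq i)

  ∙-distribˡ-+ : ∀ (a x y : Point n) → a ∙ (λ i → x i + y i) ≈ a ∙ x + a ∙ y
  ∙-distribˡ-+ a x y =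
    trans (sum-cong-≋ λ i → distribˡ (a i) (x i) (y i)) (∑-distrib-+ (λ i → a i * x i) (λ i → a i * y i))

  ∙-*-comm : ∀ (a : Point n) t x → a ∙ (λ i → t * x i) ≈ t * (a ∙ x)
  ∙-*-comm a t x = trans
    (sum-cong-≋ λ i → solve 3 (λ a t x → a :* (t :* x) := t :* (a :* x)) refl (a i) t (x i))
    (sym (*-distribˡ-sum t λ i → a i * x i))

  ∙-linear : ∀ (a : Point n) t x y → a ∙ (λ i → x i + t * y i) ≈ a ∙ x + t * (a ∙ y)
  ∙-linear a t x y =
    trans (∙-distribˡ-+ a x (λ i → t * y i)) (+-congˡ (∙-*-comm a t y))

  -- conv P is Cone P 1#.
  Cone : Pred (ZeroOneVector n) p → Carrier → Pred (Point n) _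
  Cone {n = n} P τ x =
    ∃[ k ] Σ[ v ∈ (Fin k → ZeroOneVector n) ] Σ[ w ∈ Vector Carrier k ]
      (∀ i → P (v i))
      × (∀ i → 0# ≤ w i)
      × sum w ≈ τ
      × x ≋ (λ j → sum λ i → w i * bit (v i j))

  -- When `g * (1# + t) ≈ 1#`, this is the convex combination with weights in the ratio 1 to `t`.
  mix : Carrier → Carrier → Point n → Point n → Point n
  mix g t x y j = g * (x j + t * y j)

  module _ (P : Pred (ZeroOneVector n) p) where

    Cone-resp : ∀ {τ σ x y} → τ ≈ σ → x ≋ y → Cone P τ x → Cone P σ y
    Cone-resp τ≈σ x≋y (k , v , w , Pv , 0≤w , w≈τ , x≋) =
      k , v , w , Pv , 0≤w , trans w≈τ τ≈σ , λ j → trans (sym (x≋y j)) (x≋ j)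

    conv-vertex : ∀ {s} → P s → conv P (bit ∘ s)
    conv-vertex {s} Ps =
      1 , (λ _ → s) , (λ _ → 1#) , (λ _ → Ps) , (λ _ → <⇒≤ 0<1) , +-identityʳ 1# ,
      λ j → sym (trans (+-identityʳ _) (*-identityˡ _))

    Cone-scale : ∀ {τ x t} → 0# ≤ t → Cone P τ x → Cone P (t * τ) (λ j → t * x j)
    Cone-scale {t = t} 0≤t (k , v , w , Pv , 0≤w , w≈τ , x≋) =
      k , v , (λ i → t * w i) , Pv , (λ i → *-nonNeg 0≤t (0≤w i)) ,
      trans (sym (*-distribˡ-sum t w)) (*-congˡ w≈τ) ,
      λ j → trans (*-congˡ (x≋ j)) (trans (*-distribˡ-sum t λ i → w i * bit (v i j))
        (sum-cong-≋ λ i → sym (*-assoc t (w i) (bit (v i j)))))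

    -- Concatenation of two weighted families. The first is spelled out so that the induction can
    -- move its members over one at a time.
    Cone-prepend : ∀ k (v : Fin k → ZeroOneVector n) w {σ y} →
                   (∀ i → P (v i)) → (∀ i → 0# ≤ w i) → Cone P σ y →
                   Cone P (sum w + σ) (λ j → (sum λ i → w i * bit (v i j)) + y j)
    Cone-prepend ℕ.zero v w Pv 0≤w C =
      Cone-resp (sym (+-identityˡ _)) (λ j → sym (+-identityˡ _)) C
    Cone-prepend (ℕ.suc k) v w Pv 0≤w C
      with k′ , v′ , w′ , Pv′ , 0≤w′ , w′≈ , y≋
        ← Cone-prepend k (v ∘ suc) (w ∘ suc) (Pv ∘ suc) (0≤w ∘ suc) C =
      ℕ.suc k′ ,
      (λ { 0F → v 0F ; (suc i) → v′ i }) ,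
      (λ { 0F → w 0F ; (suc i) → w′ i }) ,
      (λ { 0F → Pv 0F ; (suc i) → Pv′ i }) ,
      (λ { 0F → 0≤w 0F ; (suc i) → 0≤w′ i }) ,
      trans (+-congˡ w′≈) (sym (+-assoc _ _ _)) ,
      λ j → trans (+-assoc _ _ _) (+-congˡ (y≋ j))

    Cone-add : ∀ {τ σ x y} → Cone P τ x → Cone P σ y → Cone P (τ + σ) (λ j → x j + y j)
    Cone-add (k , v , w , Pv , 0≤w , w≈τ , x≋) C =
      Cone-resp (+-congʳ w≈τ) (λ j → +-congʳ (sym (x≋ j))) (Cone-prepend k v w Pv 0≤w C)

    Cone-nonNeg : ∀ {τ x} → Cone P τ x → ∀ j → 0# ≤ x j
    Cone-nonNeg (k , v , w , Pv , 0≤w , _ , x≋) j =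
      ≤-respʳ (sym (x≋ j)) (sum-nonNeg λ i → *-nonNeg (0≤w i) (bit-nonNeg (v i j)))

    Cone-≤ : ∀ {τ x} → Cone P τ x → ∀ j → x j ≤ τ
    Cone-≤ (k , v , w , Pv , 0≤w , w≈τ , x≋) j = ≤-respˡ (sym (x≋ j)) (≤-respʳ w≈τ
      (sum-mono-≤ λ i → ≤-respʳ (*-identityʳ (w i)) (*-monoˡ-≤ (0≤w i) (bit≤1 (v i j)))))

    Cone-subadditive : ∀ {τ x} j k l → (∀ {z} → P z → bit (z j) ≤ bit (z k) + bit (z l)) →
                       Cone P τ x → x j ≤ x k + x l
    Cone-subadditive j k l bound (_ , v , w , Pv , 0≤w , _ , x≋) =
      ≤-respˡ (sym (x≋ j)) (≤-respʳ split
        (sum-mono-≤ λ i → *-monoˡ-≤ (0≤w i) (bound (Pv i))))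
      where
      split = trans (sum-cong-≋ λ i → distribˡ (w i) _ _)
                    (trans (∑-distrib-+ (λ i → w i * bit (v i k)) (λ i → w i * bit (v i l)))
                           (sym (+-cong (x≋ k) (x≋ l))))

    -- Weights with sum 1 include a positive one, and its vertex is split off. The remainder stays
    -- unnormalised in a cone, because its total weight `τ` may be zero and cannot be divided out.
    conv-split : ∀ {z} → conv P z →
      ∃[ s ] ∃[ t ] ∃[ τ ] ∃[ r ]
        P s × 0# < t × Cone P τ r × t + τ ≈ 1# × (∀ j → z j ≈ t * bit (s j) + r j)
    conv-split (k , v , w , Pv , 0≤w , w≈1 , z≋)
      with positive-summand w (<-respʳ (sym w≈1) 0<1)
    conv-split (ℕ.suc k , v , w , Pv , 0≤w , w≈1 , z≋) | i , 0<wᵢ =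
      v i , w i , sum (removeAt w i) , _ , Pv i , 0<wᵢ ,
      (k , removeAt v i , removeAt w i , Pv ∘ punchIn i , 0≤w ∘ punchIn i , refl , λ _ → refl) ,
      trans (sym (sum-remove w)) w≈1 ,
      λ j → trans (z≋ j) (sum-remove λ i → w i * bit (v i j))

    conv-mix : ∀ {g t x y} → 0# ≤ g → 0# ≤ t → g * (1# + t) ≈ 1# →
               conv P x → conv P y → conv P (mix g t x y)
    conv-mix {t = t} 0≤g 0≤t gt≈1 Cx Cy = Cone-resp
      (trans (*-congˡ (+-congˡ (*-identityʳ t))) gt≈1) (λ _ → refl)
      (Cone-scale 0≤g (Cone-add Cx (Cone-scale 0≤t Cy)))

  bit-≋⇒≗ : ∀ {u v : ZeroOneVector n} → (bit ∘ u) ≋ (bit ∘ v) → u ≗ v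
  bit-≋⇒≗ eq i = bit-injective (eq i)

  apply-cong : ∀ (α : AffineMap m n) {x y} → x ≋ y → apply α x ≋ apply α y
  apply-cong α eq i = +-congʳ (∙-congˡ (AffineMap.linear α i) eq)

  apply-mix : ∀ (α : AffineMap m n) {g t} x y → g * (1# + t) ≈ 1# →
              apply α (mix g t x y) ≋ mix g t (apply α x) (apply α y)
  apply-mix α {g} {t} x y gt≈1 i = begin
    L ∙ mix g t x y + T
      ≈⟨ +-cong (trans (∙-*-comm L g (λ j → x j + t * y j)) (*-congˡ (∙-linear L t x y)))
                -- Written as `g * (1# + t) * T`, the translation can be shared between the two
                -- points in the ratio of their weights.
                (trans (sym (*-identityˡ T)) (*-congʳ (sym gt≈1))) ⟩
    g * (L ∙ x + t * (L ∙ y)) + g * (1# + t) * T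
      ≈⟨ solve 5 (λ g t X Y T → g :* (X :+ t :* Y) :+ g :* (con 1 :+ t) :* T
                             := g :* ((X :+ T) :+ t :* (Y :+ T))) refl g t (L ∙ x) (L ∙ y) T ⟩
    g * ((L ∙ x + T) + t * (L ∙ y + T))
      ∎
    where
    L = AffineMap.linear α i
    T = AffineMap.translation α i

  -- Both sides contain the translation exactly twice, so only the linear part matters.
  apply-+ : ∀ (α : AffineMap m n) x y x′ y′ → (∀ i → x i + y i ≈ x′ i + y′ i) →
            ∀ i → apply α x i + apply α y i ≈ apply α x′ i + apply α y′ i
  apply-+ α x y x′ y′ eq i = begin
    L ∙ x + T + (L ∙ y + T)             ≈⟨ regroup x y ⟩
    L ∙ (λ j → x j + y j) + (T + T)     ≈⟨ +-congʳ (∙-congˡ L eq) ⟩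
    L ∙ (λ j → x′ j + y′ j) + (T + T)   ≈⟨ regroup x′ y′ ⟨
    L ∙ x′ + T + (L ∙ y′ + T)           ∎
    where
    L = AffineMap.linear α i
    T = AffineMap.translation α i
    regroup : ∀ x y → L ∙ x + T + (L ∙ y + T) ≈ L ∙ (λ j → x j + y j) + (T + T)
    regroup x y = trans
      (solve 3 (λ X Y T → X :+ T :+ (Y :+ T) := X :+ Y :+ (T :+ T)) refl (L ∙ x) (L ∙ y) T)
      (+-congʳ (sym (∙-distribˡ-+ L x y)))

  module _ (P : Pred (ZeroOneVector m) p) (α : AffineMap m n) (injective : InjectiveOn α (conv P)) where

    -- Injectivity is known on the hull only. Dividing by `1# + t` turns both combinations into
    -- points of the hull, and multiplying back gives the equation.
    combination-injective : ∀ {x y x′ y′ t} → 0# < t →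
      conv P x → conv P y → conv P x′ → conv P y′ →
      (∀ i → apply α x i + t * apply α y i ≈ apply α x′ i + t * apply α y′ i) →
      ∀ j → x j + t * y j ≈ x′ j + t * y′ j
    combination-injective {x} {y} {x′} {y′} {t} 0<t Cx Cy Cx′ Cy′ eq j
      using g , 0≤g , g[1+t]≈1 ← positive⇒invertible
             (<-trans 0<1 (<-respˡ (+-identityʳ 1#) (+-monoʳ-< 1# 0<t))) = begin
      x j + t * y j                    ≈⟨ unscale _ ⟨
      (1# + t) * (g * (x j + t * y j)) ≈⟨ *-congˡ (injective _ _
        (conv-mix P 0≤g (<⇒≤ 0<t) g[1+t]≈1 Cx Cy)
        (conv-mix P 0≤g (<⇒≤ 0<t) g[1+t]≈1 Cx′ Cy′)
        (λ i → trans (apply-mix α x y g[1+t]≈1 i)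
          (trans (*-congˡ (eq i)) (sym (apply-mix α x′ y′ g[1+t]≈1 i)))) j) ⟩
      (1# + t) * (g * (x′ j + t * y′ j)) ≈⟨ unscale _ ⟩
      x′ j + t * y′ j                  ∎
      where
      unscale : ∀ z → (1# + t) * (g * z) ≈ z
      unscale z = trans (sym (*-assoc _ g z))
        (trans (*-congʳ (trans (*-comm _ g) g[1+t]≈1)) (*-identityˡ z))

  module Reduction (P : Pred (ZeroOneVector m) p) (Q : Pred (ZeroOneVector n) q)
                   (P≤Q : P ≤ₐ Q) where

    α : AffineMap m n
    α = proj₁ P≤Q

    injective : InjectiveOn α (conv P)
    injective = proj₁ (proj₂ P≤Q)

    private
      a : Point n
      a = proj₁ (proj₂ (proj₂ P≤Q))

      b : Carrier
      b = proj₁ (proj₂ (proj₂ (proj₂ P≤Q)))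

      valid : ∀ x → conv Q x → a ∙ x ≤ b
      valid = proj₁ (proj₂ (proj₂ (proj₂ (proj₂ P≤Q))))

      image⇔face : ∀ y → Image α (conv P) y ⇔ (conv Q y × a ∙ y ≈ b)
      image⇔face = proj₂ (proj₂ (proj₂ (proj₂ (proj₂ P≤Q))))

      in-face : ∀ {x} → conv P x → conv Q (apply α x) × a ∙ apply α x ≈ b
      in-face {x} Cx = Equivalence.to (image⇔face _) (x , Cx , λ _ → refl)

    -- The functional of the face takes the value `b` on both images, hence `b + t * b` on
    -- `u + t v`. Validity bounds it by `b` on `u` and on `v`, so it is tight on each, and both lie
    -- in the face, which is the image of the hull.
    lift : ∀ {x₁ x₂ u v t} → 0# < t → conv P x₁ → conv P x₂ → conv Q u → conv Q v →
      (∀ i → u i + t * v i ≈ apply α x₁ i + t * apply α x₂ i) →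
      ∃[ x ] ∃[ y ] conv P x × conv P y × apply α x ≋ u × apply α y ≋ v ×
        (∀ j → x j + t * y j ≈ x₁ j + t * x₂ j)
    lift {x₁} {x₂} {u} {v} {t} 0<t Cx₁ Cx₂ Cu Cv eq
      using au≈b , av≈b ← tight-sum 0<t (valid u Cu) (valid v Cv) (begin
             a ∙ u + t * (a ∙ v)                     ≈⟨ ∙-linear a t u v ⟨
             a ∙ (λ i → u i + t * v i)               ≈⟨ ∙-congˡ a eq ⟩
             a ∙ (λ i → apply α x₁ i + t * apply α x₂ i)
               ≈⟨ ∙-linear a t (apply α x₁) (apply α x₂) ⟩
             a ∙ apply α x₁ + t * (a ∙ apply α x₂)
               ≈⟨ +-cong (proj₂ (in-face Cx₁)) (*-congˡ (proj₂ (in-face Cx₂))) ⟩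
             b + t * b                               ∎)
      using x , Cx , αx≋u ← Equivalence.from (image⇔face u) (Cu , au≈b)
      using y , Cy , αy≋v ← Equivalence.from (image⇔face v) (Cv , av≈b) =
      x , y , Cx , Cy , αx≋u , αy≋v ,
      combination-injective P α injective 0<t Cx Cy Cx₁ Cx₂ λ i →
        trans (+-cong (αx≋u i) (*-congˡ (αy≋v i))) (eq i)

    private
      1*ʳ : ∀ y z → y + 1# * z ≈ y + z
      1*ʳ y z = +-congˡ (*-identityˡ z)

    lift-+ : ∀ {x₁ x₂ u v} → conv P x₁ → conv P x₂ → conv Q u → conv Q v →
      (∀ i → u i + v i ≈ apply α x₁ i + apply α x₂ i) →
      ∃[ x ] ∃[ y ] conv P x × conv P y × apply α x ≋ u × apply α y ≋ v ×
        (∀ j → x j + y j ≈ x₁ j + x₂ j)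
    lift-+ Cx₁ Cx₂ Cu Cv eq
      using x , y , Cx , Cy , αx≋u , αy≋v , sums
        ← lift 0<1 Cx₁ Cx₂ Cu Cv (λ i → trans (1*ʳ _ _) (trans (eq i) (sym (1*ʳ _ _)))) =
      x , y , Cx , Cy , αx≋u , αy≋v , λ j → trans (sym (1*ʳ _ _)) (trans (sums j) (1*ʳ _ _))

    -- Write α(p₀) = t s + r with s ∈ Q and t > 0.  Then α(p₀) is a convex
    -- combination of s and of r′ = (1 + t) r + t² s; both lift to conv P, and
    -- p₀ is extreme there.
    vertex-image : ∀ {p₀} → P p₀ → ∃[ s ] Q s × apply α (bit ∘ p₀) ≋ (bit ∘ s)
    vertex-image {p₀} Pp₀
      using s , t , τ , r , Qs , 0<t , Cr , t+τ≈1 , αp≋ ← conv-split Q (proj₁ (in-face (conv-vertex P Pp₀)))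
      using x , y , Cx , Cy , αx≋r′ , αy≋s , sums
        ← lift {u = λ j → (1# + t) * r j + t * t * bit (s j)} 0<t
            (conv-vertex P Pp₀) (conv-vertex P Pp₀)
            (Cone-resp Q
              (begin
                (1# + t) * τ + t * t * 1#
                  ≈⟨ solve 2 (λ t τ → (con 1 :+ t) :* τ :+ t :* t :* con 1
                                    := τ :+ t :* (t :+ τ)) refl t τ ⟩
                τ + t * (t + τ)  ≈⟨ +-congˡ (trans (*-congˡ t+τ≈1) (*-identityʳ t)) ⟩
                τ + t            ≈⟨ trans (+-comm τ t) t+τ≈1 ⟩
                1#               ∎)
              (λ _ → refl)
              (Cone-add Q
                (Cone-scale Q (+-nonNeg (<⇒≤ 0<1) (<⇒≤ 0<t)) Cr)
                (Cone-scale Q (<⇒≤ (*-pos 0<t 0<t)) (conv-vertex Q Qs))))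
            (conv-vertex Q Qs)
            (λ j → begin
              (1# + t) * r j + t * t * bit (s j) + t * bit (s j)
                ≈⟨ solve 3 (λ t r s → (con 1 :+ t) :* r :+ t :* t :* s :+ t :* s
                     := (t :* s :+ r) :+ t :* (t :* s :+ r)) refl t (r j) (bit (s j)) ⟩
              (t * bit (s j) + r j) + t * (t * bit (s j) + r j)
                ≈⟨ +-cong (αp≋ j) (*-congˡ (αp≋ j)) ⟨
              apply α (bit ∘ p₀) j + t * apply α (bit ∘ p₀) j ∎) =
      s , Qs , λ i → trans (apply-cong α (λ j → sym (y≋p j)) i) (αy≋s i)
      where
      y≋p : y ≋ (bit ∘ p₀)
      y≋p j = 0/1-extreme (p₀ j) 0<t (Cone-nonNeg P Cx j) (Cone-≤ P Cx j)
                (Cone-nonNeg P Cy j) (Cone-≤ P Cy j) (sums j)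

-- Line segments and the number of 0/1 points.

≢⇒≡⊎≡ : ∀ {a b : Fin 2} → a ≢ b → ∀ d → d ≡ a ⊎ d ≡ b
≢⇒≡⊎≡ {0F} {0F} a≢b _  = contradiction ≡.refl a≢b
≢⇒≡⊎≡ {0F} {1F} _ 0F = inj₁ ≡.refl
≢⇒≡⊎≡ {0F} {1F} _ 1F = inj₂ ≡.refl
≢⇒≡⊎≡ {1F} {0F} _ 0F = inj₂ ≡.refl
≢⇒≡⊎≡ {1F} {0F} _ 1F = inj₁ ≡.refl
≢⇒≡⊎≡ {1F} {1F} a≢b _  = contradiction ≡.refl a≢b

module LineSegments {c ℓ₁ ℓ₂ : Level} (K : OrderedField c ℓ₁ ℓ₂) where
  open OrderedField K
  open OrderedFieldProperties K
  open Polytope K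
  open PolytopeProperties K
  open SemiringSum semiring using (sum)
  open VectorEquality setoid using (_≋_)
  open SemiringSolver commutativeSemiring using (solve; _:+_; _:*_; _:=_)
  open SetoidReasoning setoid

  segment-direction : ∀ t a b → (1# - t) * a + t * b ≈ a + t * (b - a)
  segment-direction t a b = begin
    (1# - t) * a + t * b              ≈⟨ +-congˡ (*-congˡ ([x-y]+y≈x b a)) ⟨
    (1# - t) * a + t * (b - a + a)    ≈⟨ solve 4 (λ u t a e → u :* a :+ t :* (e :+ a)
                                           := (u :+ t) :* a :+ t :* e) refl (1# - t) t a (b - a) ⟩
    (1# - t + t) * a + t * (b - a)    ≈⟨ +-congʳ (trans (*-congʳ ([x-y]+y≈x 1# t)) (*-identityˡ a)) ⟩
    a + t * (b - a)                   ∎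

  -- Parameters at which a coordinate takes the values 1 and 0 exhibit an inverse of its slope `d`,
  -- which `unit-cancel` then uses for cancellation.
  unit-difference : ∀ {a d s r} → a + s * d ≈ 1# → a + r * d ≈ 0# → (s - r) * d ≈ 1#
  unit-difference {a} {d} {s} {r} eq₁ eq₀ = +-cancelˡ (a + r * d) (begin
    a + r * d + (s - r) * d   ≈⟨ solve 4 (λ a r d e → a :+ r :* d :+ e :* d
                                            := a :+ (e :+ r) :* d) refl a r d (s - r) ⟩
    a + (s - r + r) * d       ≈⟨ +-congˡ (*-congʳ ([x-y]+y≈x s r)) ⟩
    a + s * d                 ≈⟨ eq₁ ⟩
    1#                        ≈⟨ +-identityˡ 1# ⟨
    0# + 1#                   ≈⟨ +-congʳ eq₀ ⟨
    a + r * d + 1#            ∎)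

  unit-cancel : ∀ {g d t s} → g * d ≈ 1# → t * d ≈ s * d → t ≈ s
  unit-cancel {g} {d} {t} {s} gd≈1 eq = begin
    t             ≈⟨ expand t ⟩
    g * (t * d)   ≈⟨ *-congˡ eq ⟩
    g * (s * d)   ≈⟨ expand s ⟨
    s             ∎
    where
    expand : ∀ x → x ≈ g * (x * d)
    expand x = begin
      x             ≈⟨ *-identityˡ x ⟨
      1# * x        ≈⟨ *-congʳ gd≈1 ⟨
      g * d * x     ≈⟨ solve 3 (λ g d x → g :* d :* x := g :* (x :* d)) refl g d x ⟩
      g * (x * d)   ∎

  -- The coordinate takes both values 0 and 1 on the line, so its slope is invertible and the value
  -- determines the parameter.
  0/1-parameter : ∀ {a d} x y {t s r} → x ≢ y →
                  bit x ≈ a + t * d → bit y ≈ a + s * d → bit x ≈ a + r * d → t ≈ r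
  0/1-parameter {a} x y x≢y eq-x eq-y eq-x′ with
    t*d≈r*d ← +-cancelˡ a (trans (sym eq-x) eq-x′) | x | y
  ... | 0F | 0F = contradiction ≡.refl x≢y
  ... | 0F | 1F = unit-cancel (unit-difference (sym eq-y) (sym eq-x)) t*d≈r*d
  ... | 1F | 0F = unit-cancel (unit-difference (sym eq-x) (sym eq-y)) t*d≈r*d
  ... | 1F | 1F = contradiction ≡.refl x≢y

  module _ (P : Pred (ZeroOneVector n) p) (segment : IsLineSegment (conv P)) where

    private
      a b : Point n
      a = proj₁ segment
      b = proj₁ (proj₂ segment)

      on-line : ∀ {u} → P u → Σ[ t ∈ Carrier ] (∀ j → bit (u j) ≈ a j + t * (b j - a j))
      on-line Pu
        using t , _ , _ , eq ← Equivalence.to (proj₂ (proj₂ (proj₂ segment)) _) (conv-vertex P Pu) =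
        t , λ j → trans (eq j) (segment-direction t (a j) (b j))

    separating-coordinate : ∀ u v {w j} → P u → P v → P w → u j ≢ v j → w j ≡ u j → u ≗ w
    separating-coordinate u v {w} {j} Pu Pv Pw u≢v w≡u =
      bit-≋⇒≗ (same (on-line Pu) (on-line Pv) (on-line Pw))
      where
      Line : ZeroOneVector n → Set _
      Line u = Σ[ t ∈ Carrier ] (∀ j → bit (u j) ≈ a j + t * (b j - a j))
      same : Line u → Line v → Line w → (bit ∘ u) ≋ (bit ∘ w)
      same (t , u≈) (s , v≈) (r , w≈) l = begin
        bit (u l)               ≈⟨ u≈ l ⟩
        a l + t * (b l - a l)   ≈⟨ +-congˡ (*-congʳ (0/1-parameter (u j) (v j) u≢v (u≈ j) (v≈ j)
                                     (trans (reflexive (≡.cong bit (≡.sym w≡u))) (w≈ j)))) ⟩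
        a l + r * (b l - a l)   ≈⟨ w≈ l ⟨
        bit (w l)               ∎

  -- A coordinate that separates two 0/1 points of a line is injective on the
  -- line, so a third 0/1 point coincides with one of the two.
  three-points⇒¬segment : (P : Pred (ZeroOneVector n) p) →
                          MoreThanTwoPoints P → ¬ IsLineSegment (conv P)
  three-points⇒¬segment {n = n} P (v , Pv , distinct) segment
    with j , v₀ⱼ≢v₁ⱼ ← ¬∀⟶∃¬ n _ (λ j → v 0F j ≟ v 1F j) (λ eq → contradiction (distinct eq) λ ())
    with ≢⇒≡⊎≡ v₀ⱼ≢v₁ⱼ (v 2F j)
  ... | inj₁ eq = contradiction (distinct (separating-coordinate P segment
    (v 0F) (v 1F) (Pv 0F) (Pv 1F) (Pv 2F) v₀ⱼ≢v₁ⱼ eq)) λ ()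
  ... | inj₂ eq = contradiction (distinct (separating-coordinate P segment
    (v 1F) (v 0F) (Pv 1F) (Pv 0F) (Pv 2F) (≡.≢-sym v₀ⱼ≢v₁ⱼ) eq)) λ ()

  module _ {P : Pred (ZeroOneVector n) p} {s t} (Ps : P s) (Pt : P t) (s≇t : ¬ (s ≗ t))
           (only : ∀ {z} → P z → z ≗ s ⊎ z ≗ t) where

    private
      -- Every member of the family equals `s` or `t`, so its weight is credited to `σ` or to `τ`
      -- accordingly.
      two-point-sum : ∀ k (v : Fin k → ZeroOneVector n) w → (∀ i → P (v i)) → (∀ i → 0# ≤ w i) →
        ∃[ σ ] ∃[ τ ] 0# ≤ σ × 0# ≤ τ × σ + τ ≈ sum w ×
          (∀ j → (sum λ i → w i * bit (v i j)) ≈ σ * bit (s j) + τ * bit (t j))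
      two-point-sum ℕ.zero v w Pv 0≤w =
        0# , 0# , ≈⇒≤ refl , ≈⇒≤ refl , +-identityˡ 0# ,
        λ j → sym (trans (+-cong (zeroˡ _) (zeroˡ _)) (+-identityˡ 0#))
      two-point-sum (ℕ.suc k) v w Pv 0≤w
        with two-point-sum k (v ∘ suc) (w ∘ suc) (Pv ∘ suc) (0≤w ∘ suc) | only (Pv 0F)
      ... | σ , τ , 0≤σ , 0≤τ , σ+τ≈ , eq | inj₁ v₀≗s =
        w 0F + σ , τ , +-nonNeg (0≤w 0F) 0≤σ , 0≤τ ,
        trans (+-assoc _ σ τ) (+-congˡ σ+τ≈) , λ j →
          trans (+-cong (*-congˡ (reflexive (≡.cong bit (v₀≗s j)))) (eq j))
            (solve 5 (λ w σ τ s t → w :* s :+ (σ :* s :+ τ :* t) := (w :+ σ) :* s :+ τ :* t)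
              refl (w 0F) σ τ (bit (s j)) (bit (t j)))
      ... | σ , τ , 0≤σ , 0≤τ , σ+τ≈ , eq | inj₂ v₀≗t =
        σ , w 0F + τ , 0≤σ , +-nonNeg (0≤w 0F) 0≤τ ,
        trans (solve 3 (λ w σ τ → σ :+ (w :+ τ) := w :+ (σ :+ τ)) refl (w 0F) σ τ) (+-congˡ σ+τ≈) , λ j →
          trans (+-cong (*-congˡ (reflexive (≡.cong bit (v₀≗t j)))) (eq j))
            (solve 5 (λ w σ τ s t → w :* t :+ (σ :* s :+ τ :* t) := σ :* s :+ (w :+ τ) :* t)
              refl (w 0F) σ τ (bit (s j)) (bit (t j)))

    two-points⇒segment : IsLineSegment (conv P)
    two-points⇒segment =
      bit ∘ s , bit ∘ t , (λ eq → s≇t (bit-≋⇒≗ eq)) , λ x → mk⇔ to (from x)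
      where
      to : ∀ {x} → conv P x → Σ[ r ∈ Carrier ] 0# ≤ r × r ≤ 1# ×
             x ≋ (λ j → (1# - r) * bit (s j) + r * bit (t j))
      to (k , v , w , Pv , 0≤w , w≈1 , x≋)
        using σ , τ , 0≤σ , 0≤τ , σ+τ≈w , eq ← two-point-sum k v w Pv 0≤w =
        -- The parameter is the total weight of `t`; since all weights sum to 1, the weight of `s`
        -- is `1# - τ`.
        τ , 0≤τ ,
        ≤-respˡ (+-identityˡ τ) (≤-respʳ (trans σ+τ≈w w≈1) (+-monoˡ-≤ τ 0≤σ)) ,
        λ j → trans (x≋ j) (trans (eq j) (+-congʳ (*-congʳ
          (trans (sym ([x+y]-y≈x σ τ)) (+-congʳ (trans σ+τ≈w w≈1))))))
      from : ∀ x → (Σ[ r ∈ Carrier ] 0# ≤ r × r ≤ 1# ×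
             x ≋ (λ j → (1# - r) * bit (s j) + r * bit (t j))) → conv P x
      from x (r , 0≤r , r≤1 , x≋) = Cone-resp P
        (trans (+-cong (*-identityʳ _) (*-identityʳ r)) ([x-y]+y≈x 1# r))
        (λ j → sym (x≋ j))
        (Cone-add P (Cone-scale P (x≤y⇒0≤y-x r≤1) (conv-vertex P Ps))
                    (Cone-scale P 0≤r (conv-vertex P Pt)))

-- Locating the three ones of a row.

ones : (Fin n → Fin 2) → ℕ
ones f = sumℕ (toℕ ∘ f)

one-one : (f : Fin n → Fin 2) → ones f ≡ 1 → ∃[ i ] f i ≡ 1F
one-one {n = ℕ.suc n} f eq with f 0F in f₀
... | 1F = 0F , f₀
... | 0F with i , fᵢ ← one-one (f ∘ suc) eq = suc i , fᵢ

two-ones : (f : Fin n → Fin 2) → ones f ≡ 2 → ∃[ i ] ∃[ j ] i Fin.< j × f i ≡ 1F × f j ≡ 1F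
two-ones {n = ℕ.suc n} f eq with f 0F in f₀
... | 1F with j , fⱼ ← one-one (f ∘ suc) (ℕ.suc-injective eq) = 0F , suc j , ℕ.z<s , f₀ , fⱼ
... | 0F with i , j , i<j , fᵢ , fⱼ ← two-ones (f ∘ suc) eq = suc i , suc j , ℕ.s<s i<j , fᵢ , fⱼ

three-ones : (f : Fin n → Fin 2) → ones f ≡ 3 →
  ∃[ i ] ∃[ j ] ∃[ k ] i Fin.< j × j Fin.< k × f i ≡ 1F × f j ≡ 1F × f k ≡ 1F
three-ones {n = ℕ.suc n} f eq with f 0F in f₀
... | 1F with j , k , j<k , fⱼ , fₖ ← two-ones (f ∘ suc) (ℕ.suc-injective eq) =
  0F , suc j , suc k , ℕ.z<s , ℕ.s<s j<k , f₀ , fⱼ , fₖ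
... | 0F with i , j , k , i<j , j<k , fᵢ , fⱼ , fₖ ← three-ones (f ∘ suc) eq =
  suc i , suc j , suc k , ℕ.s<s i<j , ℕ.s<s j<k , fᵢ , fⱼ , fₖ

-- Points of `NPadj A`, their symmetries and a finite search.

antipode : ZeroOneVector n → ZeroOneVector n
antipode z = opposite ∘ z

-- The search runs over codes in `Fin (2 ^ n)`. Decoding the code of a vector returns it only up to
-- pointwise equality, hence the hypothesis that `P` respects `_≗_`.
any0/1? : {P : Pred (ZeroOneVector n) p} → (∀ {u v} → u ≗ v → P u → P v) →
          Decidable P → Dec (∃[ z ] P z)
any0/1? resp P? = map′
  (λ (i , Pi) → finToFun i , Pi)
  (λ (z , Pz) → funToFin z , resp (λ i → ≡.sym (finToFun-funToFin z i)) Pz)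
  (any? λ i → P? (finToFun i))

module Assembly (n : ℕ) where
  open Coordinates n

  -- Blocks `0F`, `1F`, `2F` hold the coordinates `x`, `x̄`, `x′`, in the layout fixed by
  -- `Coordinates`.
  assemble : (Fin 3 → Fin n → Fin 2) → (Fin 3 → Fin 2) → ZeroOneVector (3 ℕ.* n ℕ.+ 3)
  assemble blocks ys i =
    [ (λ c → uncurry blocks (remQuot n c)) , ys ]′ (splitAt (3 ℕ.* n) i)

  assemble-block : ∀ blocks ys b j → assemble blocks ys (combine b j ↑ˡ 3) ≡ blocks b j
  assemble-block blocks ys b j =
    ≡.trans (≡.cong [ _ , _ ]′ (splitAt-↑ˡ (3 ℕ.* n) (combine b j) 3))
          (≡.cong (uncurry blocks) (remQuot-combine b j))

  assemble-y : ∀ blocks ys i → assemble blocks ys ((3 ℕ.* n) ↑ʳ i) ≡ ys i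
  assemble-y blocks ys i = ≡.cong [ _ , _ ]′ (splitAt-↑ʳ (3 ℕ.* n) 3 i)

  coordinatewise : {u v : ZeroOneVector (3 ℕ.* n ℕ.+ 3)} →
    (∀ b j → u (combine {3} b j ↑ˡ 3) ≡ v (combine {3} b j ↑ˡ 3)) →
    (∀ i → u ((3 ℕ.* n) ↑ʳ i) ≡ v ((3 ℕ.* n) ↑ʳ i)) → u ≗ v
  coordinatewise {u} {v} blocks ys i with splitAt (3 ℕ.* n) i in eq
  ... | inj₂ k = ≡.subst (λ i → u i ≡ v i) (splitAt⁻¹-↑ʳ eq) (ys k)
  ... | inj₁ c = ≡.subst (λ i → u i ≡ v i)
    (≡.trans (≡.cong (_↑ˡ 3) (combine-remQuot {3} n c)) (splitAt⁻¹-↑ˡ eq))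
    (uncurry blocks (remQuot {3} n c))

  origin-blocks : Fin 3 → Fin n → Fin 2
  origin-blocks 0F _ = 0F
  origin-blocks 1F _ = 1F
  origin-blocks 2F _ = 1F

  origin : ZeroOneVector (3 ℕ.* n ℕ.+ 3)
  origin = assemble origin-blocks (λ _ → 0F)

  blocks : ZeroOneVector (3 ℕ.* n ℕ.+ 3) → Fin 3 → Fin n → Fin 2
  blocks z b j = z (combine b j ↑ˡ 3)

  swapped-ys : ZeroOneVector (3 ℕ.* n ℕ.+ 3) → Fin 3 → Fin 2
  swapped-ys z 0F = z y₂
  swapped-ys z 1F = z y₁
  swapped-ys z 2F = z y₃

  swap : ZeroOneVector (3 ℕ.* n ℕ.+ 3) → ZeroOneVector (3 ℕ.* n ℕ.+ 3)
  swap z = assemble (blocks z) (swapped-ys z)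

-- The argument `holds` is found by evaluating `P?`, so a statement about finitely many bits is
-- proved by running through all cases.
by-exhaustion : {P : Set p} (P? : Dec P) {holds : True P?} → P
by-exhaustion P? {holds} = toWitness holds

opposite-+₁ : ∀ (a b : Fin 2) → toℕ a ℕ.+ toℕ b ≡ 1 → toℕ (opposite a) ℕ.+ toℕ (opposite b) ≡ 1
opposite-+₁ = by-exhaustion (all? λ a → all? λ b → (_ ℕ.≟ _) →-dec (_ ℕ.≟ _))

opposite-+₂ : ∀ (a b c d : Fin 2) → toℕ a ℕ.+ toℕ b ℕ.+ toℕ c ℕ.+ toℕ d ≡ 2 →
  toℕ (opposite a) ℕ.+ toℕ (opposite b) ℕ.+ toℕ (opposite c) ℕ.+ toℕ (opposite d) ≡ 2
opposite-+₂ = by-exhaustion (all? λ a → all? λ b → all? λ c → all? λ d → (_ ℕ.≟ _) →-dec (_ ℕ.≟ _))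

link-at-00 : ∀ (x x̄ x′ : Fin 2) → toℕ x ℕ.+ toℕ x̄ ≡ 1 → toℕ x′ ℕ.+ toℕ x̄ ≡ 2 →
             x ≡ 0F × x̄ ≡ 1F × x′ ≡ 1F
link-at-00 = by-exhaustion (all? λ x → all? λ x̄ → all? λ x′ →
  (_ ℕ.≟ _) →-dec (_ ℕ.≟ _) →-dec (x ≟ 0F) ×-dec (x̄ ≟ 1F) ×-dec (x′ ≟ 1F))

y₃-at-00 : ∀ (a : Fin 2) → toℕ a ℕ.+ 0 ℕ.+ 1 ℕ.+ 1 ≡ 2 → a ≡ 0F
y₃-at-00 0F _ = ≡.refl
y₃-at-00 1F ()

module _ {m n : ℕ} {A : Fin m → Fin n → Fin 2} where
  open Coordinates n
  open Assembly n
  open NPadj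

  NPadj-resp : ∀ {u v} → u ≗ v → NPadj A u → NPadj A v
  NPadj-resp eq U .complement j
    rewrite ≡.sym (eq (x j)) | ≡.sym (eq (x̄ j)) = U .complement j
  NPadj-resp eq U .link j
    rewrite ≡.sym (eq y₁) | ≡.sym (eq y₂) | ≡.sym (eq (x′ j)) | ≡.sym (eq (x̄ j)) = U .link j
  NPadj-resp eq U .row r i j k i<j j<k Aᵢ Aⱼ Aₖ
    rewrite ≡.sym (eq y₃) | ≡.sym (eq (x i)) | ≡.sym (eq (x′ j)) | ≡.sym (eq (x′ k)) =
    U .row r i j k i<j j<k Aᵢ Aⱼ Aₖ

  NPadj? : Decidable (NPadj A)
  NPadj? z = map′
    (λ (c , l , r) → record { complement = c ; link = l ; row = r })
    (λ Z → Z .complement , Z .link , Z .row)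
    ( (all? λ j → _ ℕ.≟ _)
    ×-dec (all? λ j → _ ℕ.≟ _)
    ×-dec (all? λ r → all? λ i → all? λ j → all? λ k →
            (i <? j) →-dec (j <? k) →-dec (A r i ≟ 1F) →-dec (A r j ≟ 1F) →-dec (A r k ≟ 1F)
            →-dec (_ ℕ.≟ _)))

  assemble∈NPadj : ∀ (blocks : Fin 3 → Fin n → Fin 2) (ys : Fin 3 → Fin 2) →
    (∀ j → toℕ (blocks 0F j) ℕ.+ toℕ (blocks 1F j) ≡ 1) →
    (∀ j → toℕ (ys 0F) ℕ.+ toℕ (ys 1F) ℕ.+ toℕ (blocks 2F j) ℕ.+ toℕ (blocks 1F j) ≡ 2) →
    (∀ r i j k → i Fin.< j → j Fin.< k → A r i ≡ 1F → A r j ≡ 1F → A r k ≡ 1F →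
      toℕ (ys 2F) ℕ.+ toℕ (blocks 0F i) ℕ.+ toℕ (blocks 2F j) ℕ.+ toℕ (blocks 2F k) ≡ 2) →
    NPadj A (assemble blocks ys)
  assemble∈NPadj blocks ys c l r .complement j
    rewrite assemble-block blocks ys 0F j | assemble-block blocks ys 1F j = c j
  assemble∈NPadj blocks ys c l r .link j
    rewrite assemble-y blocks ys 0F | assemble-y blocks ys 1F
          | assemble-block blocks ys 2F j | assemble-block blocks ys 1F j = l j
  assemble∈NPadj blocks ys c l r .row s i j k i<j j<k Aᵢ Aⱼ Aₖ
    rewrite assemble-y blocks ys 2F | assemble-block blocks ys 0F i
          | assemble-block blocks ys 2F j | assemble-block blocks ys 2F k =
    r s i j k i<j j<k Aᵢ Aⱼ Aₖ

  origin∈NPadj : NPadj A origin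
  origin∈NPadj = assemble∈NPadj origin-blocks (λ _ → 0F)
    (λ _ → ≡.refl) (λ _ → ≡.refl) (λ _ _ _ _ _ _ _ _ _ → ≡.refl)

  -- The coordinates `y₁` and `y₂` enter the equations only through their sum.
  swap∈NPadj : ∀ {z} → NPadj A z → NPadj A (swap z)
  swap∈NPadj {z} Z = assemble∈NPadj (blocks z) (swapped-ys z) (Z .complement)
    (λ j → ≡.trans (≡.cong (λ s → s ℕ.+ toℕ (z (x′ j)) ℕ.+ toℕ (z (x̄ j)))
                       (ℕ.+-comm (toℕ (z y₂)) (toℕ (z y₁))))
                 (Z .link j))
    (Z .row)

  -- Each right-hand side is half the number of terms on the left, so complementing all terms
  -- preserves the equation.
  antipode∈NPadj : ∀ {z} → NPadj A z → NPadj A (antipode z)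
  antipode∈NPadj {z} Z .complement j = opposite-+₁ (z (x j)) (z (x̄ j)) (Z .complement j)
  antipode∈NPadj {z} Z .link j =
    opposite-+₂ (z y₁) (z y₂) (z (x′ j)) (z (x̄ j)) (Z .link j)
  antipode∈NPadj {z} Z .row r i j k i<j j<k Aᵢ Aⱼ Aₖ =
    opposite-+₂ (z y₃) (z (x i)) (z (x′ j)) (z (x′ k)) (Z .row r i j k i<j j<k Aᵢ Aⱼ Aₖ)

  values-at-00 : ∀ {z} → NPadj A z → z y₁ ≡ 0F → z y₂ ≡ 0F →
              ∀ j → z (x j) ≡ 0F × z (x̄ j) ≡ 1F × z (x′ j) ≡ 1F
  values-at-00 {z} Z y₁≡0 y₂≡0 j = link-at-00 (z (x j)) (z (x̄ j)) (z (x′ j)) (Z .complement j)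
    (≡.trans (≡.cong₂ (λ a b → toℕ a ℕ.+ toℕ b ℕ.+ toℕ (z (x′ j)) ℕ.+ toℕ (z (x̄ j)))
      (≡.sym y₁≡0) (≡.sym y₂≡0)) (Z .link j))

  module _ (1≤m : 1 ℕ.≤ m) (rows : ThreeOnesPerRow A) where

    -- With `y₁` and `y₂` zero, `link` forces `x̄` and `x′` to be 1 and `complement` then settles
    -- `x`. Only a row equation reaches `y₃`, and `1≤m` supplies a row.
    only-origin : ∀ {z} → NPadj A z → z y₁ ≡ 0F → z y₂ ≡ 0F → z ≗ origin
    only-origin {z} Z y₁≡0 y₂≡0 = coordinatewise
      (λ { 0F j → ≡.trans (proj₁ (at j)) (≡.sym (assemble-block origin-blocks (λ _ → 0F) 0F j))
         ; 1F j → ≡.trans (proj₁ (proj₂ (at j))) (≡.sym (assemble-block origin-blocks (λ _ → 0F) 1F j))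
         ; 2F j → ≡.trans (proj₂ (proj₂ (at j))) (≡.sym (assemble-block origin-blocks (λ _ → 0F) 2F j)) })
      (λ { 0F → ≡.trans y₁≡0 (≡.sym (assemble-y origin-blocks (λ _ → 0F) 0F))
         ; 1F → ≡.trans y₂≡0 (≡.sym (assemble-y origin-blocks (λ _ → 0F) 1F))
         ; 2F → ≡.trans y₃≡0 (≡.sym (assemble-y origin-blocks (λ _ → 0F) 2F)) })
      where
      at = values-at-00 Z y₁≡0 y₂≡0
      y₃≡0 : z y₃ ≡ 0F
      y₃≡0 with i , j , k , i<j , j<k , Aᵢ , Aⱼ , Aₖ ← three-ones _ (rows (Fin.fromℕ< 1≤m)) =
        y₃-at-00 (z y₃) (≡.trans
          (≡.cong₂ ℕ._+_ (≡.cong₂ ℕ._+_ (≡.cong (λ a → toℕ (z y₃) ℕ.+ toℕ a) (≡.sym (proj₁ (at i))))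
            (≡.cong toℕ (≡.sym (proj₂ (proj₂ (at j)))))) (≡.cong toℕ (≡.sym (proj₂ (proj₂ (at k))))))
          (Z .row _ i j k i<j j<k Aᵢ Aⱼ Aₖ))

    -- The cases are the values of `y₁` and `y₂`: both 0 is `only-origin`, both 1 reduces to it by
    -- complementing, and the two unequal pairs are interchanged by `swap`.
    origin-or-antipode : ¬ (∃[ z ] NPadj A z × z y₁ ≡ 0F × z y₂ ≡ 1F) →
                         ∀ {z} → NPadj A z → z ≗ origin ⊎ z ≗ antipode origin
    origin-or-antipode ∄ {z} Z with z y₁ in y₁≡ | z y₂ in y₂≡
    ... | 0F | 0F = inj₁ (only-origin Z y₁≡ y₂≡)
    ... | 0F | 1F = contradiction (z , Z , y₁≡ , y₂≡) ∄
    ... | 1F | 0F = contradiction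
      (swap z , swap∈NPadj Z ,
       ≡.trans (assemble-y (blocks z) (swapped-ys z) 0F) y₂≡ ,
       ≡.trans (assemble-y (blocks z) (swapped-ys z) 1F) y₁≡) ∄
    ... | 1F | 1F = inj₂ λ i → ≡.trans (≡.sym (opposite-involutive (z i)))
      (≡.cong opposite (only-origin (antipode∈NPadj Z) (≡.cong opposite y₁≡) (≡.cong opposite y₂≡) i))

    -- Deciding existence makes it possible to obtain an actual point from the negative hypothesis
    -- that the hull is not a segment.
    mixed? : Dec (∃[ z ] NPadj A z × z y₁ ≡ 0F × z y₂ ≡ 1F)
    mixed? = any0/1?
      (λ eq (Z , y₁≡0 , y₂≡1) → NPadj-resp eq Z , ≡.trans (≡.sym (eq y₁)) y₁≡0 , ≡.trans (≡.sym (eq y₂)) y₂≡1)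
      (λ z → NPadj? z ×-dec (z y₁ ≟ 0F) ×-dec (z y₂ ≟ 1F))

-- Coordinatewise majority and stable sets.

majority : Fin 2 → Fin 2 → Fin 2 → Fin 2
majority 0F 0F c = 0F
majority 0F 1F c = c
majority 1F 0F c = c
majority 1F 1F c = 1F

-- If both majorities were 1, two of the three pairs would have first entry 1 and two would have
-- second entry 1, so some pair would have both.
majority-≤ : ∀ a a′ b b′ c c′ → toℕ a ℕ.+ toℕ a′ ℕ.≤ 1 → toℕ b ℕ.+ toℕ b′ ℕ.≤ 1 →
  toℕ c ℕ.+ toℕ c′ ℕ.≤ 1 → toℕ (majority a b c) ℕ.+ toℕ (majority a′ b′ c′) ℕ.≤ 1
majority-≤ = by-exhaustion (all? λ a → all? λ a′ → all? λ b → all? λ b′ → all? λ c → all? λ c′ →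
  (_ ℕ.≤? _) →-dec (_ ℕ.≤? _) →-dec (_ ℕ.≤? _) →-dec (_ ℕ.≤? _))

-- If the common sum is 0 or 2, all six bits agree. If it is 1, then `c` and `c*` are the two
-- different bits: they break the tie in opposite ways where `a` and `b` differ, and have no
-- influence where these agree.
majority-splitˡ : ∀ (a a* b b* c c* : Fin 2) →
  toℕ a ℕ.+ toℕ a* ≡ toℕ b ℕ.+ toℕ b* → toℕ a ℕ.+ toℕ a* ≡ toℕ c ℕ.+ toℕ c* →
  toℕ (majority a b c) ℕ.+ toℕ (majority a b c*) ≡ toℕ a ℕ.+ toℕ b
majority-splitˡ = by-exhaustion (all? λ a → all? λ a* → all? λ b → all? λ b* → all? λ c → all? λ c* →
  (_ ℕ.≟ _) →-dec (_ ℕ.≟ _) →-dec (_ ℕ.≟ _))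

-- Here `b` and `b*` break the tie between `a` and `c`. The order of the arguments is kept, so that
-- `majority a b c` is the same term in both decompositions.
majority-splitʳ : ∀ (a a* b b* c c* : Fin 2) →
  toℕ a ℕ.+ toℕ a* ≡ toℕ b ℕ.+ toℕ b* → toℕ a ℕ.+ toℕ a* ≡ toℕ c ℕ.+ toℕ c* →
  toℕ (majority a b c) ℕ.+ toℕ (majority a b* c) ≡ toℕ a ℕ.+ toℕ c
majority-splitʳ = by-exhaustion (all? λ a → all? λ a* → all? λ b → all? λ b* → all? λ c → all? λ c* →
  (_ ℕ.≟ _) →-dec (_ ℕ.≟ _) →-dec (_ ℕ.≟ _))

majorities : ZeroOneVector n → ZeroOneVector n → ZeroOneVector n → ZeroOneVector n
majorities a b c v = majority (a v) (b v) (c v)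

majorities-stable : ∀ (G : Graph) a b c → Stable G a → Stable G b → Stable G c →
                    Stable G (majorities a b c)
majorities-stable G a b c Sa Sb Sc u v uv =
  majority-≤ (a u) (a v) (b u) (b v) (c u) (c v) (Sa u v uv) (Sb u v uv) (Sc u v uv)

-- Impossibility of a reduction to stable sets.

module NPadjPolytope {c ℓ₁ ℓ₂ : Level} (K : OrderedField c ℓ₁ ℓ₂) {m n : ℕ} (A : Fin m → Fin n → Fin 2) where
  open OrderedField K
  open OrderedFieldProperties K
  open Polytope K
  open PolytopeProperties K
  open LineSegments K
  open VectorEquality setoid using (_≋_)
  open Coordinates n
  open Assembly n

  bit-opposite : ∀ a → bit a + bit (opposite a) ≈ 1#
  bit-opposite 0F = +-identityˡ 1#
  bit-opposite 1F = +-identityʳ 1#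

  bit-opposite≉ : ∀ a → ¬ (bit a ≈ bit (opposite a))
  bit-opposite≉ 0F eq = 0≉1 eq
  bit-opposite≉ 1F eq = 0≉1 (sym eq)

  -- It is enough to check 0/1 points: if `y₁` and `y₂` vanish, so does `x j`, and otherwise the
  -- right side is at least 1.
  x≤y₁+y₂ : ∀ j {z} → conv (NPadj A) z → z (x j) ≤ z y₁ + z y₂
  x≤y₁+y₂ j = Cone-subadditive (NPadj A) (x j) y₁ y₂ bound
    where
    bound : ∀ {z} → NPadj A z → bit (z (x j)) ≤ bit (z y₁) + bit (z y₂)
    bound {z} Z with z y₁ in y₁≡ | z y₂ in y₂≡
    ... | 0F | 0F = ≈⇒≤ (trans (reflexive (≡.cong bit (proj₁ (values-at-00 Z y₁≡ y₂≡ j))))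
                               (sym (+-identityˡ 0#)))
    ... | 0F | 1F = ≤-respʳ (sym (+-identityˡ 1#)) (bit≤1 (z (x j)))
    ... | 1F | b  = ≤-trans (bit≤1 (z (x j)))
                            (≤-respˡ (+-identityʳ 1#) (+-monoʳ-≤ 1# (bit-nonNeg b)))

  x≈0 : ∀ j {z} → conv (NPadj A) z → z y₁ ≈ 0# → z y₂ ≈ 0# → z (x j) ≈ 0#
  x≈0 j Cz y₁≈0 y₂≈0 = ≤-antisym
    (≤-respʳ (trans (+-cong y₁≈0 y₂≈0) (+-identityˡ 0#)) (x≤y₁+y₂ j Cz))
    (Cone-nonNeg (NPadj A) Cz (x j))

  -- The y-coordinates force M and N to have y₁ = y₂ = 0, hence x = 0; then the
  -- x-coordinates of B are those of q and of its antipode at once.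
  no-decompositions : ∀ {q B C M N} → Fin n → q y₁ ≡ 0F → q y₂ ≡ 1F →
    conv (NPadj A) B → conv (NPadj A) C → conv (NPadj A) M → conv (NPadj A) N →
    (∀ i → B i + M i ≈ bit (origin i) + bit (q i)) →
    (∀ i → C i + M i ≈ bit (origin i) + bit (swap q i)) →
    (∀ i → B i + N i ≈ bit (origin i) + bit (antipode (swap q) i)) →
    ⊥
  no-decompositions {q} {B} {C} {M} {N} j qy₁≡0 qy₂≡1 CB CC CM CN B+M C+M B+N =
    bit-opposite≉ (q (x j)) (trans (sym Bx≈q) Bx≈opposite-q)
    where
    at : ∀ {s} {a b a′ b′ : Fin 2} → s ≈ bit a + bit b → a ≡ a′ → b ≡ b′ → s ≈ bit a′ + bit b′
    at eq ≡.refl ≡.refl = eq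

    origin-y : ∀ i → origin ((3 ℕ.* n) ↑ʳ i) ≡ 0F
    origin-y = assemble-y origin-blocks (λ _ → 0F)
    origin-x : origin (x j) ≡ 0F
    origin-x = assemble-block origin-blocks (λ _ → 0F) 0F j
    swap-y₁ : swap q y₁ ≡ 1F
    swap-y₁ = ≡.trans (assemble-y (blocks q) (swapped-ys q) 0F) qy₂≡1
    swap-y₂ : swap q y₂ ≡ 0F
    swap-y₂ = ≡.trans (assemble-y (blocks q) (swapped-ys q) 1F) qy₁≡0
    swap-x : swap q (x j) ≡ q (x j)
    swap-x = assemble-block (blocks q) (swapped-ys q) 0F j

    nonNeg : ∀ {z} → conv (NPadj A) z → ∀ i → 0# ≤ z i
    nonNeg = Cone-nonNeg (NPadj A)

    B+M-y₁ : B y₁ + M y₁ ≈ 0#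
    B+M-y₁ = trans (at (B+M y₁) (origin-y 0F) qy₁≡0) (+-identityˡ 0#)
    C+M-y₂ : C y₂ + M y₂ ≈ 0#
    C+M-y₂ = trans (at (C+M y₂) (origin-y 1F) swap-y₂) (+-identityˡ 0#)
    B+N-y₁ : B y₁ + N y₁ ≈ 0#
    B+N-y₁ = trans (at (B+N y₁) (origin-y 0F) (≡.cong opposite swap-y₁)) (+-identityˡ 0#)
    My₁≈0 : M y₁ ≈ 0#
    My₁≈0 = proj₂ (nonNeg-sum≈0 (nonNeg CB y₁) (nonNeg CM y₁) B+M-y₁)
    My₂≈0 : M y₂ ≈ 0#
    My₂≈0 = proj₂ (nonNeg-sum≈0 (nonNeg CC y₂) (nonNeg CM y₂) C+M-y₂)
    Ny₁≈0 : N y₁ ≈ 0#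
    Ny₁≈0 = proj₂ (nonNeg-sum≈0 (nonNeg CB y₁) (nonNeg CN y₁) B+N-y₁)
    -- At `y₂` both `B + M` and `B + N` equal 1, because `q` and the antipode of `swap q` agree
    -- there. Hence `N` inherits the value of `M`.
    Ny₂≈0 : N y₂ ≈ 0#
    Ny₂≈0 = trans (+-cancelˡ (B y₂) (trans (at (B+N y₂) (origin-y 1F) (≡.cong opposite swap-y₂))
      (sym (at (B+M y₂) (origin-y 1F) qy₂≡1)))) My₂≈0

    drop : ∀ {a b s} → b ≈ 0# → a + b ≈ 0# + s → a ≈ s
    drop b≈0 eq = trans (sym (+-identityʳ _)) (trans (+-congˡ (sym b≈0)) (trans eq (+-identityˡ _)))
    Bx≈q : B (x j) ≈ bit (q (x j))
    Bx≈q = drop (x≈0 j CM My₁≈0 My₂≈0) (at {b = q (x j)} (B+M (x j)) origin-x ≡.refl)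
    Bx≈opposite-q : B (x j) ≈ bit (opposite (q (x j)))
    Bx≈opposite-q = drop (x≈0 j CN Ny₁≈0 Ny₂≈0)
      (at (B+N (x j)) origin-x (≡.cong opposite swap-x))

  module _ (G : Graph) (R : NPadj A ≤ₐ Stable G) where
    open Reduction (NPadj A) (Stable G) R

    private
      Images : ZeroOneVector _ → ZeroOneVector _ → Set _
      Images z s = apply α (bit ∘ z) ≋ (bit ∘ s)

    -- A point and its antipode always sum to the all-ones vector, so affinity gives all pairs of
    -- images the same sum. This is the hypothesis of the majority identities.
    antipodal-sums : ∀ z z′ s s* t t* → Images z s → Images (antipode z) s* →
      Images z′ t → Images (antipode z′) t* →
      ∀ v → toℕ (s v) ℕ.+ toℕ (s* v) ≡ toℕ (t v) ℕ.+ toℕ (t* v)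
    antipodal-sums z z′ s s* t t* αz αz* αz′ αz′* v =
      bit-+⇒toℕ-+ (s v) (s* v) (t v) (t* v) (trans (sym (+-cong (αz v) (αz* v))) (trans
        (apply-+ α (bit ∘ z) (bit ∘ antipode z) (bit ∘ z′) (bit ∘ antipode z′)
          (λ i → trans (bit-opposite (z i)) (sym (bit-opposite (z′ i)))) v)
        (+-cong (αz′ v) (αz′* v))))

    stable-lift : ∀ {z₁ z₂} s₁ s₂ u v → NPadj A z₁ → NPadj A z₂ →
      Images z₁ s₁ → Images z₂ s₂ → Stable G u → Stable G v →
      (∀ i → toℕ (u i) ℕ.+ toℕ (v i) ≡ toℕ (s₁ i) ℕ.+ toℕ (s₂ i)) →
      ∃[ X ] ∃[ Y ] conv (NPadj A) X × conv (NPadj A) Y ×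
        apply α X ≋ (bit ∘ u) × apply α Y ≋ (bit ∘ v) ×
        (∀ j → X j + Y j ≈ bit (z₁ j) + bit (z₂ j))
    stable-lift s₁ s₂ u v Z₁ Z₂ αz₁ αz₂ Su Sv eq =
      lift-+ (conv-vertex (NPadj A) Z₁) (conv-vertex (NPadj A) Z₂)
             (conv-vertex (Stable G) {u} Su) (conv-vertex (Stable G) {v} Sv)
             (λ i → trans (toℕ-+⇒bit-+ (u i) (v i) (s₁ i) (s₂ i) (eq i))
                          (sym (+-cong (αz₁ i) (αz₂ i))))

    private
      StableImage : ZeroOneVector _ → Set _
      StableImage z = ∃[ s ] Stable G s × Images z s

    -- Three decompositions are lifted. The first two share the summand `majorities a b c`, the
    -- first and third share `majorities a b c*`; injectivity identifies the corresponding lifts,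
    -- which gives the system refuted by `no-decompositions`.
    stable-images-clash : ∀ {q} → Fin n → NPadj A q → q y₁ ≡ 0F → q y₂ ≡ 1F →
      StableImage origin → StableImage (antipode origin) →
      StableImage q → StableImage (antipode q) →
      StableImage (swap q) → StableImage (antipode (swap q)) → ⊥
    stable-images-clash {q} j Zq qy₁≡0 qy₂≡1
      (a , Sa , αa) (a* , _ , αa*) (b , Sb , αb) (b* , Sb* , αb*) (c , Sc , αc) (c* , Sc* , αc*)
      using a≡b ← antipodal-sums origin q a a* b b* αa αa* αb αb*
          | a≡c ← antipodal-sums origin (swap q) a a* c c* αa αa* αc αc*
      using M , B , CM , CB , αM , αB , M+B ←
              stable-lift a b (majorities a b c) (majorities a b c*) origin∈NPadj Zq αa αb
                (majorities-stable G a b c Sa Sb Sc) (majorities-stable G a b c* Sa Sb Sc*)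
                (λ v → majority-splitˡ (a v) (a* v) (b v) (b* v) (c v) (c* v) (a≡b v) (a≡c v))
          | M′ , C , CM′ , CC , αM′ , _ , M′+C ←
              stable-lift a c (majorities a b c) (majorities a b* c) origin∈NPadj (swap∈NPadj Zq) αa αc
                (majorities-stable G a b c Sa Sb Sc) (majorities-stable G a b* c Sa Sb* Sc)
                (λ v → majority-splitʳ (a v) (a* v) (b v) (b* v) (c v) (c* v) (a≡b v) (a≡c v))
          -- The second decomposition with `c` and `c*` exchanged, hence the commuted sum.
          | B′ , N , CB′ , CN , αB′ , _ , B′+N ←
              stable-lift a c* (majorities a b c*) (majorities a b* c*)
                origin∈NPadj (antipode∈NPadj (swap∈NPadj Zq)) αa αc*
                (majorities-stable G a b c* Sa Sb Sc*) (majorities-stable G a b* c* Sa Sb* Sc*)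
                (λ v → majority-splitʳ (a v) (a* v) (b v) (b* v) (c* v) (c v) (a≡b v)
                         (≡.trans (a≡c v) (ℕ.+-comm (toℕ (c v)) (toℕ (c* v)))))
      = no-decompositions j qy₁≡0 qy₂≡1 CB CC CM CN
          (λ i → trans (+-comm _ _) (M+B i))
          (λ i → trans (+-comm _ _) (trans
            (+-congʳ (injective M M′ CM CM′ (λ v → trans (αM v) (sym (αM′ v))) i)) (M′+C i)))
          (λ i → trans
            (+-congʳ (injective B B′ CB CB′ (λ v → trans (αB v) (sym (αB′ v))) i)) (B′+N i))

    no-reduction : Fin n → ¬ (∃[ q ] NPadj A q × q y₁ ≡ 0F × q y₂ ≡ 1F)
    no-reduction j (q , Zq , qy₁≡0 , qy₂≡1) = stable-images-clash j Zq qy₁≡0 qy₂≡1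
      (vertex-image Zo) (vertex-image (antipode∈NPadj Zo))
      (vertex-image Zq) (vertex-image (antipode∈NPadj Zq))
      (vertex-image Zs) (vertex-image (antipode∈NPadj Zs))
      where
      Zo = origin∈NPadj
      Zs = swap∈NPadj Zq

  -- Segments and points with unequal `y₁` and `y₂`.

  module _ (1≤m : 1 ℕ.≤ m) (rows : ThreeOnesPerRow A) where

    origin-y₁ : origin y₁ ≡ 0F
    origin-y₁ = assemble-y origin-blocks (λ _ → 0F) 0F

    origin-y₂ : origin y₂ ≡ 0F
    origin-y₂ = assemble-y origin-blocks (λ _ → 0F) 1F

    ¬segment⇒mixed : ¬ IsLineSegment (conv (NPadj A)) → ∃[ q ] NPadj A q × q y₁ ≡ 0F × q y₂ ≡ 1F
    ¬segment⇒mixed ¬segment with mixed? 1≤m rows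
    ... | yes mixed  = mixed
    ... | no ¬mixed  = contradiction
      (two-points⇒segment origin∈NPadj (antipode∈NPadj origin∈NPadj)
        (λ eq → contradiction (≡.trans (≡.sym origin-y₁) (≡.trans (eq y₁) (≡.cong opposite origin-y₁))) λ ())
        (origin-or-antipode 1≤m rows ¬mixed))
      ¬segment

    -- The values of `y₁` and `y₂` alone tell the three points apart: 0 and 0, 0 and 1, 1 and 1.
    mixed⇒three-points : (∃[ q ] NPadj A q × q y₁ ≡ 0F × q y₂ ≡ 1F) → MoreThanTwoPoints (NPadj A)
    mixed⇒three-points (q , Zq , qy₁≡0 , qy₂≡1) = points , members , distinct
      where
      points : Fin 3 → ZeroOneVector (3 ℕ.* n ℕ.+ 3)
      points 0F = origin
      points 1F = q
      points 2F = antipode origin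
      members : ∀ i → NPadj A (points i)
      members 0F = origin∈NPadj
      members 1F = Zq
      members 2F = antipode∈NPadj origin∈NPadj
      y₁-of y₂-of : Fin 3 → Fin 2
      y₁-of 0F = 0F
      y₁-of 1F = 0F
      y₁-of 2F = 1F
      y₂-of 0F = 0F
      y₂-of 1F = 1F
      y₂-of 2F = 1F
      y₁≡ : ∀ i → points i y₁ ≡ y₁-of i
      y₁≡ 0F = origin-y₁
      y₁≡ 1F = qy₁≡0
      y₁≡ 2F = ≡.cong opposite origin-y₁
      y₂≡ : ∀ i → points i y₂ ≡ y₂-of i
      y₂≡ 0F = origin-y₂
      y₂≡ 1F = qy₂≡1
      y₂≡ 2F = ≡.cong opposite origin-y₂
      determined : ∀ i j → y₁-of i ≡ y₁-of j → y₂-of i ≡ y₂-of j → i ≡ j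
      determined = by-exhaustion (all? λ i → all? λ j → (_ ≟ _) →-dec (_ ≟ _) →-dec (_ ≟ _))
      distinct : ∀ {i j} → points i ≗ points j → i ≡ j
      distinct {i} {j} eq = determined i j
        (≡.trans (≡.sym (y₁≡ i)) (≡.trans (eq y₁) (y₁≡ j)))
        (≡.trans (≡.sym (y₂≡ i)) (≡.trans (eq y₂) (y₂≡ j)))

open import Data.Nat.Base using (_≤_)

theorem2 : ∀ {c ℓ₁ ℓ₂} (K : OrderedField c ℓ₁ ℓ₂) → let open Polytope K in
    (m n : ℕ) → 1 ≤ m → 1 ≤ n →
    (A : Fin m → Fin n → Fin 2) → ThreeOnesPerRow A →
    ((¬ IsLineSegment (conv (NPadj A))) ⇔ MoreThanTwoPoints (NPadj A))
    × (¬ IsLineSegment (conv (NPadj A)) → ¬ (∃[ G ] NPadj A ≤ₐ Stable G))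
theorem2 K m n 1≤m 1≤n A rows =
  mk⇔ (λ ¬segment → mixed⇒three-points 1≤m rows (¬segment⇒mixed 1≤m rows ¬segment))
      (three-points⇒¬segment (NPadj A)) ,
  -- The bound `1≤n` supplies the column whose `x`-coordinate would have to equal its own
  -- complement.
  λ ¬segment (G , R) → no-reduction G R (Fin.fromℕ< 1≤n) (¬segment⇒mixed 1≤m rows ¬segment)
  where
  open NPadjPolytope K A
  open LineSegments K
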